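{- Let $T$ be a finite tree with exactly $k$ support vertices $v_1,\dots,v_k$, where $v_i$ is adjacent to exactly $\ell_i$ leaves and $\ell_1\le\ell_2\le\cdots\le\ell_k$. Let $T'$ be the subgraph of $T$ induced by the non-leaf vertices, and let $m=\sum_{i=1}^k\ell_i$. If $\Delta(T)<m$, then $\chi'_L(T)\le \Delta(T')+\ell_k+k-1$. Moreover, equality holds if and only if $T$ is a double star $S_{p,p}$.
   Context: A leaf is a vertex of degree $1$; a support vertex is a vertex adjacent to a leaf. $\Delta(\cdot)$ is the maximum degree. The double star $S_{p,p}$ is the tree consisting of two adjacent vertices each adjacent to $p$ further leaves. For a proper edge coloring $c:E(G)\to\{1,\dots,k\}$ of a connected graph $G$, let $\pi=(\mathcal{C}_1,\dots,\mathcal{C}_k)$ be the ordered partition of $E(G)$ into color classes. For a vertex $v$ and an edge $e=xy$, $d(v,e)=\min\{d(v,x),d(v,y)\}$, and $d(v,\mathcal{C}_i)=\min\{d(v,e): e\in\mathcal{C}_i\}$. The edge color code of $v$ is $c_\pi(v)=(d(v,\mathcal{C}_1),\dots,d(v,\mathcal{C}_k))$. The coloring is an edge-locating coloring if distinct vertices have distinct edge color codes; $\chi'_L(G)$ is the minimum number of colors in an edge-locating coloring of $G$.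
   Formalization: The tree T is assumed to have at least 3 vertices; this excludes only the single-edge tree K_2, which satisfies Δ(T)<m but has no edge-locating coloring, so χ'_L is undefined for it. -}

module Defs where

open import Data.Nat using (ℕ; zero; suc; _+_; _∸_; _≤_; _<_; _⊔_; _≡ᵇ_; _≤ᵇ_)
open import Data.Bool using (Bool; true; false; _∧_; _∨_; not)
open import Data.Fin using (Fin; toℕ; inject₁; fromℕ) renaming (zero to fzero; suc to fsuc)
open import Data.List using (List; length; filterᵇ; allFin; map; foldr)
open import Data.Nat.ListAction using (sum)
open import Data.Product using (Σ; ∃; _×_; _,_)
open import Relation.Binary.PropositionalEquality using (_≡_; _≢_)
open import Function using (Injective)
open import Function.Bundles using (_↔_; _⇔_; Inverse)

record Graph (n : ℕ) : Set where
  field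
    adj    : Fin n → Fin n → Bool
    sym    : ∀ x y → adj x y ≡ adj y x
    irrefl : ∀ x → adj x x ≡ false
open Graph public

module _ {n : ℕ} (G : Graph n) where

  countV : (Fin n → Bool) → ℕ
  countV p = length (filterᵇ p (allFin n))

  maxV : (Fin n → ℕ) → ℕ
  maxV f = foldr _⊔_ 0 (map f (allFin n))

  sumV : (Fin n → ℕ) → ℕ
  sumV f = sum (map f (allFin n))

  deg : Fin n → ℕ
  deg v = countV (adj G v)

  Δ : ℕ
  Δ = maxV deg

  isLeaf : Fin n → Bool
  isLeaf v = deg v ≡ᵇ 1

  leafNbrs : Fin n → ℕ
  leafNbrs v = countV (λ y → adj G v y ∧ isLeaf y)

  isSupport : Fin n → Bool
  isSupport v = 1 ≤ᵇ leafNbrs v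

  numSupport : ℕ
  numSupport = countV isSupport

  leafSum : ℕ
  leafSum = sumV (λ v → if isSupport v then leafNbrs v else 0)
    where open import Data.Bool using (if_then_else_)

  maxLeafNbrs : ℕ
  maxLeafNbrs = maxV (λ v → if isSupport v then leafNbrs v else 0)
    where open import Data.Bool using (if_then_else_)

  -- Δ(T') where T' is the subgraph induced by the non-leaf vertices:
  -- degree of a non-leaf v in T' = number of non-leaf neighbours of v.
  degInner : Fin n → ℕ
  degInner v = countV (λ y → adj G v y ∧ not (isLeaf y))

  ΔInner : ℕ
  ΔInner = maxV (λ v → if isLeaf v then 0 else degInner v)
    where open import Data.Bool using (if_then_else_)

  data Walk : Fin n → Fin n → ℕ → Set where
    here : ∀ {x} → Walk x x 0
    step : ∀ {x y z r} → adj G x y ≡ true → Walk y z r → Walk x z (suc r)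

  Connected : Set
  Connected = ∀ x y → ∃ λ r → Walk x y r

  record Cycle : Set where
    field
      len    : ℕ
      vert   : Fin (3 + len) → Fin n
      inj    : Injective _≡_ _≡_ vert
      consec : ∀ (i : Fin (2 + len)) → adj G (vert (inject₁ i)) (vert (fsuc i)) ≡ true
      close  : adj G (vert (fromℕ (2 + len))) (vert fzero) ≡ true

  Acyclic : Set
  Acyclic = Cycle → Data.Empty.⊥
    where import Data.Empty

  IsTree : Set
  IsTree = Connected × Acyclic

  -- c x y is the colour of edge xy (values on non-edges are irrelevant)
  record ProperEdgeColoring (k : ℕ) : Set where
    field
      col    : Fin n → Fin n → Fin k
      symm   : ∀ x y → adj G x y ≡ true → col x y ≡ col y x
      proper : ∀ x y z → adj G x y ≡ true → adj G x z ≡ true → y ≢ z →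
               col x y ≢ col x z
  open ProperEdgeColoring public

  IncColor : ∀ {k} → ProperEdgeColoring k → Fin n → Fin k → Set
  IncColor c x i = ∃ λ y → adj G x y ≡ true × col c x y ≡ i

  -- d(v, C_i) = r  (no r satisfies this when C_i is empty, i.e. d = ∞)
  DistClass : ∀ {k} → ProperEdgeColoring k → Fin n → Fin k → ℕ → Set
  DistClass c v i r =
    (∃ λ x → IncColor c x i × Walk v x r) ×
    (∀ x s → IncColor c x i → Walk v x s → r ≤ s)

  IsEdgeLocating : ∀ {k} → ProperEdgeColoring k → Set
  IsEdgeLocating {k} c = ∀ v w →
    (∀ (i : Fin k) (r : ℕ) → DistClass c v i r ⇔ DistClass c w i r) → v ≡ w

  HasELC : ℕ → Set
  HasELC k = Σ (ProperEdgeColoring k) IsEdgeLocating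

  ChiL≤ : ℕ → Set
  ChiL≤ b = ∃ λ k → k ≤ b × HasELC k

  ChiL≡ : ℕ → Set
  ChiL≡ b = HasELC b × (∀ k → k < b → HasELC k → Data.Empty.⊥)
    where import Data.Empty

-- The double star S_{p,p} on Fin (2 + p + p):
-- vertex 0 and 1 are the centres, 2..p+1 are leaves at 0,
-- p+2..2p+1 are leaves at 1.

dsEdge : ℕ → ℕ → ℕ → Bool
dsEdge p a b = ((a ≡ᵇ 0) ∧ (b ≡ᵇ 1))
             ∨ ((a ≡ᵇ 0) ∧ (2 ≤ᵇ b) ∧ (b ≤ᵇ suc p))
             ∨ ((a ≡ᵇ 1) ∧ (2 + p ≤ᵇ b))

doubleStarAdj : (p : ℕ) → Fin (2 + p + p) → Fin (2 + p + p) → Bool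
doubleStarAdj p i j = dsEdge p (toℕ i) (toℕ j) ∨ dsEdge p (toℕ j) (toℕ i)

IsDoubleStar : ∀ {n} → Graph n → Set
IsDoubleStar {n} G = ∃ λ p → Σ (Fin n ↔ Fin (2 + p + p)) λ f →
  ∀ x y → adj G x y ≡ doubleStarAdj p (Inverse.to f x) (Inverse.to f y)

{-# OPTIONS --safe #-}

-- Fix a support vertex w and give every other support vertex v a colour used only on one edge
-- from v to a leaf. The code of a vertex then records its distances to all support vertices but w,
-- and these separate the inner vertices: for x ≠ y, walking away from y through x, and away from x
-- through y, leads to two different support vertices, each of which tells x and y apart. A leaf sees
-- a single colour, an inner vertex at least two, and leaves with a common colour are separated by
-- their supports. Rooting the tree at w, the inner edges need Δ(T') colours and the remaining leaf
-- edges ℓ_k − 1 more, so one colour below the bound suffices if w has fewer than ℓ_k leaves or fewer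
-- than Δ(T') inner neighbours. If no such w exists, a support vertex with at most one inner
-- neighbour shows Δ(T') ≤ 1, and T is a star or some S_{p,p}. In S_{p,p} with only p + 1 colours,
-- both centres would see all colours.

module Submission where

open import Defs
open import Data.Bool using (Bool; true; false; not; _∧_; _xor_; if_then_else_)
open import Data.Bool.Properties using (∨-comm) renaming (_≟_ to _≟B_)
open import Data.Empty using (⊥; ⊥-elim)
open import Data.Fin using (Fin; zero; suc; toℕ; fromℕ; fromℕ<; inject₁; punchOut; _↑ˡ_; _↑ʳ_; splitAt)
open import Data.Fin.Properties using (any?; injective⇒≤; toℕ-injective; toℕ<n; toℕ-fromℕ<; fromℕ<-injective; punchOut-injective; toℕ-↑ˡ; toℕ-↑ʳ; splitAt-↑ˡ; splitAt-↑ʳ; splitAt⁻¹-↑ˡ; splitAt⁻¹-↑ʳ) renaming (_≟_ to _≟F_; suc-injective to Fin-suc-injective)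
open import Data.List using (List; []; _∷_; length; filterᵇ; foldr; map; tabulate; lookup)
open import Data.List.Membership.Propositional using (_∈_)
open import Data.List.Membership.Propositional.Properties using (∈-lookup)
open import Data.List.Relation.Unary.All using (All; []; _∷_) renaming (lookup to All-lookup)
open import Data.List.Relation.Unary.All.Properties using (¬Any⇒All¬)
open import Data.List.Relation.Unary.Any using (here; there) renaming (any? to Any-any?)
open import Data.Nat using (ℕ; zero; suc; _+_; _∸_; _≤_; _<_; _⊔_; _<ᵇ_; _≤ᵇ_; _≡ᵇ_; z≤n; s≤s; s≤s⁻¹; _≟_; _<?_)
open import Data.Nat.ListAction using (sum)
open import Data.Nat.Properties
open import Data.Product using (∃; _×_; _,_; proj₁; proj₂)
open import Data.Sum using (_⊎_; inj₁; inj₂; [_,_]′)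
open import Function using (Injective; _∘_; id)
open import Function.Bundles using (_⇔_; mk⇔; Equivalence; _↔_; mk↔ₛ′; Inverse)
open import Relation.Binary.Construct.Closure.ReflexiveTransitive using (Star; ε; _◅_; _◅◅_; reverse)
open import Relation.Binary.PropositionalEquality using (_≡_; _≢_; refl; trans; cong; cong₂; subst; subst₂) renaming (sym to ≡-sym)
open import Relation.Nullary using (Dec; yes; no; does)
open import Relation.Nullary.Decidable using (_×-dec_; ¬?)

private variable
  m n : ℕ

∧-true : ∀ {a b} → a ≡ true → b ≡ true → a ∧ b ≡ true
∧-true refl refl = refl

∧-true⁻ : ∀ a {b} → a ∧ b ≡ true → a ≡ true × b ≡ true
∧-true⁻ true eq = refl , eq

not-true : ∀ {a} → a ≡ false → not a ≡ true
not-true refl = refl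

not-true⁻ : ∀ {a} → not a ≡ true → a ≡ false
not-true⁻ {false} _ = refl

true≢false : ∀ {a} → a ≡ true → a ≡ false → ⊥
true≢false refl ()

-- Counting

bit : Bool → ℕ
bit b = if b then 1 else 0

-- A structurally recursive form of `countV`, so that induction on n applies directly;
-- `count-filter` links the two.
count : (Fin n → Bool) → ℕ
count {zero}  p = 0
count {suc n} p = bit (p zero) + count (p ∘ suc)

-- The number of earlier elements on which p holds. It numbers the vertices satisfying p from 0 on,
-- and these numbers later yield the colours of the edges at a vertex.
rank : (Fin n → Bool) → Fin n → ℕ
rank p zero    = 0
rank p (suc x) = bit (p zero) + rank (p ∘ suc) x

rank<count : ∀ (p : Fin n → Bool) x → p x ≡ true → rank p x < count p
rank<count p zero    px rewrite px = s≤s z≤n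
rank<count p (suc x) px = +-monoʳ-< (bit (p zero)) (rank<count (p ∘ suc) x px)

rank-injective : ∀ (p : Fin n → Bool) x y → p x ≡ true → p y ≡ true → rank p x ≡ rank p y → x ≡ y
rank-injective p zero    zero    px py eq = refl
rank-injective p zero    (suc y) px py eq rewrite px = ⊥-elim (0≢1+n eq)
rank-injective p (suc x) zero    px py eq rewrite py = ⊥-elim (0≢1+n (≡-sym eq))
rank-injective p (suc x) (suc y) px py eq =
  cong suc (rank-injective (p ∘ suc) x y px py (+-cancelˡ-≡ (bit (p zero)) _ _ eq))

select : ∀ (p : Fin n → Bool) i → i < count p → ∃ λ x → p x ≡ true × rank p x ≡ i
select {suc n} p i i< with p zero in eq
select {suc n} p zero    i< | true = zero , eq , refl
select {suc n} p (suc i) i< | true with select (p ∘ suc) i (s≤s⁻¹ i<)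
... | x , px , rx = suc x , px , trans (cong (λ b → bit b + rank (p ∘ suc) x) eq) (cong suc rx)
select {suc n} p i i< | false with select (p ∘ suc) i i<
... | x , px , rx = suc x , px , trans (cong (λ b → bit b + rank (p ∘ suc) x) eq) rx

-- Precomposing f with `select`, which inverts `rank`, gives an injection between finite sets. The
-- proof of p x is passed to f because the intended maps make sense only where p holds.
count-≤ : ∀ (p : Fin n → Bool) (f : ∀ x → p x ≡ true → Fin m) →
          (∀ x y px py → f x px ≡ f y py → x ≡ y) → count p ≤ m
count-≤ p f f-inj = injective⇒≤ {f = g} g-inj
  where
  sel : ∀ i → ∃ λ x → p x ≡ true × rank p x ≡ toℕ i
  sel i = select p (toℕ i) (toℕ<n i)
  g : Fin (count p) → Fin _
  g i = f (proj₁ (sel i)) (proj₁ (proj₂ (sel i)))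
  g-inj : Injective _≡_ _≡_ g
  g-inj {i} {j} eq = toℕ-injective
    (trans (≡-sym (proj₂ (proj₂ (sel i)))) (trans (cong (rank p) (f-inj _ _ _ _ eq)) (proj₂ (proj₂ (sel j)))))

count-≥ : ∀ (p : Fin n → Bool) (f : Fin m → Fin n) → Injective _≡_ _≡_ f → (∀ i → p (f i) ≡ true) → m ≤ count p
count-≥ p f f-inj pf = injective⇒≤ {f = λ i → fromℕ< (rank<count p (f i) (pf i))}
  λ eq → f-inj (rank-injective p _ _ (pf _) (pf _) (fromℕ<-injective _ _ _ _ eq))

count-mono : ∀ (p q : Fin n → Bool) → (∀ x → p x ≡ true → q x ≡ true) → count p ≤ count q
count-mono p q p⊆q = count-≤ p (λ x px → fromℕ< (rank<count q x (p⊆q x px)))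
  λ x y px py eq → rank-injective q x y (p⊆q x px) (p⊆q y py) (fromℕ<-injective _ _ _ _ eq)

bit-mono : ∀ a b → (a ≡ true → b ≡ true) → bit a ≤ bit b
bit-mono false b     h = z≤n
bit-mono true  true  h = ≤-refl
bit-mono true  false h with h refl
... | ()

count-mono-< : ∀ (p q : Fin n → Bool) w → (∀ x → p x ≡ true → q x ≡ true) →
               p w ≡ false → q w ≡ true → count p < count q
count-mono-< p q zero    p⊆q pw qw rewrite pw | qw = s≤s (count-mono _ _ (λ x → p⊆q (suc x)))
count-mono-< p q (suc w) p⊆q pw qw =
  +-mono-≤-< (bit-mono (p zero) (q zero) (p⊆q zero)) (count-mono-< _ _ w (λ x → p⊆q (suc x)) pw qw)

-- `allFin` is `tabulate id`, and passing to its tail turns `id` into `suc`, hence the general f.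
count-filter : ∀ (p : Fin n → Bool) (f : Fin m → Fin n) → length (filterᵇ p (tabulate f)) ≡ count (p ∘ f)
count-filter {m = zero}  p f = refl
count-filter {m = suc m} p f with p (f zero)
... | true  = cong suc (count-filter p (f ∘ suc))
... | false = count-filter p (f ∘ suc)

module _ (G : Graph n) where

  countV≡count : ∀ p → countV G p ≡ count p
  countV≡count p = count-filter p id

  rank<countV : ∀ p x → p x ≡ true → rank p x < countV G p
  rank<countV p x px = ≤-trans (rank<count p x px) (≤-reflexive (≡-sym (countV≡count p)))

  selectV : ∀ p i → i < countV G p → ∃ λ x → p x ≡ true × rank p x ≡ i
  selectV p i i< = select p i (≤-trans i< (≤-reflexive (countV≡count p)))

  countV-≤ : ∀ p (f : ∀ x → p x ≡ true → Fin m) →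
             (∀ x y px py → f x px ≡ f y py → x ≡ y) → countV G p ≤ m
  countV-≤ p f f-inj = ≤-trans (≤-reflexive (countV≡count p)) (count-≤ p f f-inj)

  countV-≥ : ∀ p (f : Fin m → Fin n) → Injective _≡_ _≡_ f → (∀ i → p (f i) ≡ true) → m ≤ countV G p
  countV-≥ p f f-inj pf = ≤-trans (count-≥ p f f-inj pf) (≤-reflexive (≡-sym (countV≡count p)))

  countV-mono : ∀ p q → (∀ x → p x ≡ true → q x ≡ true) → countV G p ≤ countV G q
  countV-mono p q p⊆q = subst₂ _≤_ (≡-sym (countV≡count p)) (≡-sym (countV≡count q)) (count-mono p q p⊆q)

  countV-mono-< : ∀ p q w → (∀ x → p x ≡ true → q x ≡ true) →
                  p w ≡ false → q w ≡ true → countV G p < countV G q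
  countV-mono-< p q w p⊆q pw qw =
    subst₂ _<_ (≡-sym (countV≡count p)) (≡-sym (countV≡count q)) (count-mono-< p q w p⊆q pw qw)

  countV>0 : ∀ p x → p x ≡ true → 1 ≤ countV G p
  countV>0 p x px = ≤-trans (s≤s z≤n) (rank<countV p x px)

  countV≤1⇒≡ : ∀ p → countV G p ≤ 1 → ∀ x y → p x ≡ true → p y ≡ true → x ≡ y
  countV≤1⇒≡ p c≤1 x y px py = rank-injective p x y px py (trans (is0 x px) (≡-sym (is0 y py)))
    where
    is0 : ∀ z → p z ≡ true → rank p z ≡ 0
    is0 z pz = n<1⇒n≡0 (≤-trans (rank<countV p z pz) c≤1)

  ≡⇒countV≤1 : ∀ p → (∀ x y → p x ≡ true → p y ≡ true → x ≡ y) → countV G p ≤ 1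
  ≡⇒countV≤1 p h = countV-≤ p (λ _ _ → zero) (λ x y px py _ → h x y px py)

  countV≥2⇒≢ : ∀ p → 2 ≤ countV G p → ∃ λ x → ∃ λ y → p x ≡ true × p y ≡ true × x ≢ y
  countV≥2⇒≢ p 2≤ with selectV p 0 (≤-trans (s≤s z≤n) 2≤) | selectV p 1 2≤
  ... | x , px , rx | y , py , ry =
    x , y , px , py , λ eq → 0≢1+n (trans (≡-sym rx) (trans (cong (rank p) eq) ry))

  f≤maxV : ∀ f v → f v ≤ maxV G f
  f≤maxV f = go id
    where
    go : (g : Fin m → Fin n) → ∀ v → f (g v) ≤ foldr _⊔_ 0 (map f (tabulate g))
    go g zero    = m≤m⊔n _ _
    go g (suc v) = ≤-trans (go (g ∘ suc) v) (m≤n⊔m _ _)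

  maxV≤ : ∀ f b → (∀ v → f v ≤ b) → maxV G f ≤ b
  maxV≤ f b f≤ = go id
    where
    go : (g : Fin m → Fin n) → foldr _⊔_ 0 (map f (tabulate g)) ≤ b
    go {zero}  g = z≤n
    go {suc m} g = ⊔-lub (f≤ (g zero)) (go (g ∘ suc))

  sumV-single : ∀ f w → (∀ v → v ≢ w → f v ≡ 0) → sumV G f ≤ f w
  sumV-single f w f≡0 = go id id
    where
    zeros : (g : Fin m → Fin n) → (∀ i → g i ≢ w) → sum (map f (tabulate g)) ≡ 0
    zeros {zero}  g g≢ = refl
    zeros {suc m} g g≢ = cong₂ _+_ (f≡0 _ (g≢ zero)) (zeros (g ∘ suc) (g≢ ∘ suc))
    -- Injectivity of g ensures that w is listed at most once.
    go : (g : Fin m → Fin n) → Injective _≡_ _≡_ g → sum (map f (tabulate g)) ≤ f w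
    go {zero}  g g-inj = z≤n
    go {suc m} g g-inj with g zero ≟F w
    ... | yes refl = ≤-reflexive (trans (cong (f (g zero) +_)
                       (zeros (g ∘ suc) λ i eq → case-0 (g-inj eq))) (+-identityʳ _))
      where
      case-0 : ∀ {i : Fin m} → suc i ≡ zero → ⊥
      case-0 ()
    ... | no g0≢w rewrite f≡0 _ g0≢w = go (g ∘ suc) (λ eq → Fin-suc-injective (g-inj eq))

-- The search runs upwards from 0 and ends at the given witness at the latest.
least : {P : ℕ → Set} → (∀ r → Dec (P r)) → ∀ r → P r → ∃ λ s → P s × (∀ t → P t → s ≤ t)
least P? r Pr with P? 0
... | yes P0 = 0 , P0 , λ _ _ → z≤n
least P? zero    Pr | no ¬P0 = ⊥-elim (¬P0 Pr)
least P? (suc r) Pr | no ¬P0 with least (P? ∘ suc) r Pr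
... | s , Ps , min = suc s , Ps , λ { zero P0 → ⊥-elim (¬P0 P0) ; (suc t) Pt → s≤s (min t Pt) }

-- Cycles from walks

module _ (G : Graph n) where

  adj-sym : ∀ {x y} → adj G x y ≡ true → adj G y x ≡ true
  adj-sym {x} {y} e = trans (Graph.sym G y x) e

  adj⇒≢ : ∀ {x y} → adj G x y ≡ true → x ≢ y
  adj⇒≢ e refl = true≢false e (Graph.irrefl G _)

  data SimplePath : List (Fin n) → Fin n → Fin n → Set where
    [_]  : ∀ x → SimplePath (x ∷ []) x x
    cons : ∀ {x y b xs} → adj G x y ≡ true → All (x ≢_) xs → SimplePath xs y b → SimplePath (x ∷ xs) x b

  lookup-injective : ∀ {xs a b} → SimplePath xs a b → Injective _≡_ _≡_ (lookup xs)
  lookup-injective [ x ]         {zero}  {zero}  eq = refl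
  lookup-injective (cons e av p) {zero}  {zero}  eq = refl
  lookup-injective (cons {xs = xs} e av p) {zero}  {suc j} eq = ⊥-elim (All-lookup av (∈-lookup {xs = xs} j) eq)
  lookup-injective (cons {xs = xs} e av p) {suc i} {zero}  eq = ⊥-elim (All-lookup av (∈-lookup {xs = xs} i) (≡-sym eq))
  lookup-injective (cons e av p) {suc i} {suc j} eq = cong suc (lookup-injective p eq)

  lookup-first : ∀ {x xs a b} → SimplePath (x ∷ xs) a b → x ≡ a
  lookup-first [ x ]        = refl
  lookup-first (cons _ _ _) = refl

  lookup-last : ∀ {x xs a b} → SimplePath (x ∷ xs) a b → lookup (x ∷ xs) (fromℕ (length xs)) ≡ b
  lookup-last [ x ] = refl
  lookup-last (cons {xs = y ∷ ys} _ _ p) = lookup-last p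

  lookup-consec : ∀ {x xs a b} → SimplePath (x ∷ xs) a b →
                  ∀ (i : Fin (length xs)) → adj G (lookup (x ∷ xs) (inject₁ i)) (lookup xs i) ≡ true
  lookup-consec (cons {xs = y ∷ ys} e _ p) zero = trans (cong (adj G _) (lookup-first p)) e
  lookup-consec (cons {xs = y ∷ ys} e _ p) (suc i) = lookup-consec p i

  -- Distinct ends force at least two vertices on the path, hence with z at least three on the
  -- cycle, as `Cycle` requires.
  cycle : ∀ {xs z a b} → SimplePath xs a b → All (z ≢_) xs → a ≢ b →
          adj G z a ≡ true → adj G b z ≡ true → Cycle G
  cycle [ x ] av a≢b _ _ = ⊥-elim (a≢b refl)
  cycle {xs = x ∷ y ∷ ys} p@(cons _ _ _) av a≢b za bz = record
    { len    = length ys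
    ; vert   = lookup (_ ∷ x ∷ y ∷ ys)
    ; inj    = lookup-injective zp
    ; consec = lookup-consec zp
    ; close  = trans (cong (λ u → adj G u _) (lookup-last zp)) bz
    }
    where zp = cons za av p
  cycle {xs = x ∷ []} (cons _ _ ()) av a≢b za bz

  -- Adjacency after deletion of z, so that `Star (Avoiding z)` is reachability in what remains.
  Avoiding : Fin n → Fin n → Fin n → Set
  Avoiding z x y = adj G x y ≡ true × z ≢ x × z ≢ y

  avoiding-sym : ∀ {z x y} → Avoiding z x y → Avoiding z y x
  avoiding-sym (e , zx , zy) = adj-sym e , zy , zx

  from-member : ∀ {xs x a b z} → All (z ≢_) xs → SimplePath xs a b → x ∈ xs →
                ∃ λ ys → SimplePath ys x b × All (z ≢_) ys
  from-member av       [ x ]            (here refl) = _ , [ x ] , av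
  from-member av       p@(cons _ _ _)   (here refl) = _ , p , av
  from-member (_ ∷ av) (cons _ _ p)     (there x∈)  = from-member av p x∈

  -- The tail is made simple first; if a already occurs on it, the path is cut to start at that
  -- occurrence.
  loop-erasure : ∀ {z a b} → z ≢ a → Star (Avoiding z) a b → ∃ λ xs → SimplePath xs a b × All (z ≢_) xs
  loop-erasure z≢a ε = _ , [ _ ] , z≢a ∷ []
  loop-erasure {a = a} z≢a ((e , _ , z≢y) ◅ r) with loop-erasure z≢y r
  ... | xs , p , av with Any-any? (a ≟F_) xs
  ... | yes a∈ = from-member av p a∈
  ... | no  a∉ = _ , cons e (¬Any⇒All¬ xs a∉) p , z≢a ∷ av

-- Walks and connectedness.

module Walks (G : Graph n) where

  -- Lets `least` find the distance between two vertices.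
  walk? : ∀ x y r → Dec (Walk G x y r)
  walk? x y zero with x ≟F y
  ... | yes refl = yes here
  ... | no  x≢y  = no λ { here → x≢y refl }
  walk? x y (suc r) with any? (λ z → (adj G x z ≟B true) ×-dec walk? z y r)
  ... | yes (z , e , w) = yes (step e w)
  ... | no ¬∃           = no λ { (step e w) → ¬∃ (_ , e , w) }

  snoc : ∀ {x y z r} → Walk G x y r → adj G y z ≡ true → Walk G x z (suc r)
  snoc here       e = step e here
  snoc (step f w) e = step f (snoc w e)

  walk-reverse : ∀ {x y r} → Walk G x y r → Walk G y x r
  walk-reverse here       = here
  walk-reverse (step e w) = snoc (walk-reverse w) (adj-sym G e)

  -- Together with connectedness this is an induction principle: a property that passes along edges
  -- need be checked at one vertex only.
  walk-closed : (S : Fin n → Set) → (∀ {x y} → adj G x y ≡ true → S x → S y) →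
                ∀ {x y r} → Walk G x y r → S x → S y
  walk-closed S cl here       s = s
  walk-closed S cl (step e w) s = walk-closed S cl w (cl e s)

≡ᵇ-true : ∀ {a b} → a ≡ b → (a ≡ᵇ b) ≡ true
≡ᵇ-true {zero} refl = refl
≡ᵇ-true {suc a} refl = ≡ᵇ-true {a} refl

≡ᵇ-true⁻ : ∀ a b → (a ≡ᵇ b) ≡ true → a ≡ b
≡ᵇ-true⁻ zero    zero    _ = refl
≡ᵇ-true⁻ (suc a) (suc b) e = cong suc (≡ᵇ-true⁻ a b e)

if-positive : ∀ a → (if 1 ≤ᵇ a then a else 0) ≡ a
if-positive zero    = refl
if-positive (suc a) = refl

-- Distances, leaves and support vertices in a tree.

module Tree (T : Graph n) (tree : IsTree T) (3≤n : 3 ≤ n) where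

  open Walks T

  Adj : Fin n → Fin n → Set
  Adj x y = adj T x y ≡ true

  Leaf Inner Support : Fin n → Set
  Leaf v    = isLeaf T v ≡ true
  Inner v   = isLeaf T v ≡ false
  Support v = isSupport T v ≡ true

  leaf-or-inner : ∀ v → Leaf v ⊎ Inner v
  leaf-or-inner v with isLeaf T v
  ... | true  = inj₁ refl
  ... | false = inj₂ refl

  abstract
    shortest : ∀ x y → ∃ λ r → Walk T x y r × (∀ s → Walk T x y s → r ≤ s)
    shortest x y = least (walk? x y) (proj₁ (proj₁ tree x y)) (proj₂ (proj₁ tree x y))

  d : Fin n → Fin n → ℕ
  d x y = proj₁ (shortest x y)

  d-walk : ∀ x y → Walk T x y (d x y)
  d-walk x y = proj₁ (proj₂ (shortest x y))

  d-min : ∀ {x y s} → Walk T x y s → d x y ≤ s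
  d-min {x} {y} w = proj₂ (proj₂ (shortest x y)) _ w

  d-sym : ∀ x y → d x y ≡ d y x
  d-sym x y = ≤-antisym (d-min (walk-reverse (d-walk y x))) (d-min (walk-reverse (d-walk x y)))

  d-refl : ∀ x → d x x ≡ 0
  d-refl x = n≤0⇒n≡0 (d-min (here {x = x}))

  d≡0⇒≡ : ∀ {x y} → d x y ≡ 0 → x ≡ y
  d≡0⇒≡ {x} {y} eq with d x y | d-walk x y
  d≡0⇒≡ refl | _ | here = refl

  d-adj : ∀ {x y} u → Adj x y → d x u ≤ suc (d y u)
  d-adj {x} {y} u e = d-min (step e (d-walk y u))

  closer : ∀ z y → z ≢ y → ∃ λ a → Adj z a × d z y ≡ suc (d a y)
  closer z y z≢y with d z y in eq | d-walk z y
  ... | _ | here = ⊥-elim (z≢y refl)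
  ... | suc r | step {y = a} e w = a , e , ≤-antisym (subst (_≤ _) eq (d-adj y e)) (s≤s (d-min w))

  -- Each step lowers the distance to y by one. As a starts no farther from y than z, all later
  -- vertices are strictly nearer than z and so differ from it.
  geodesic : ∀ k {z a} y → d a y ≡ k → d a y ≤ d z y → z ≢ a → Star (Avoiding T z) a y
  geodesic zero    y eq _ _ = subst (Star _ _) (d≡0⇒≡ eq) ε
  geodesic (suc k) {z} {a} y eq a≤z z≢a
    with closer a y (λ { refl → 0≢1+n (trans (≡-sym (d-refl a)) eq) })
  ... | a′ , e , eq′ = (e , z≢a , z≢a′) ◅ geodesic k y (suc-injective (trans (≡-sym eq′) eq)) (<⇒≤ a′<z) z≢a′
    where
    a′<z : d a′ y < d z y
    a′<z = subst (_≤ d z y) eq′ a≤z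
    z≢a′ : z ≢ a′
    z≢a′ refl = <-irrefl refl a′<z

  -- Otherwise the geodesics from a and b to y would close up to a cycle through z.
  unique-closer : ∀ {z a b} y → Adj z a → Adj z b → d a y ≤ d z y → d b y ≤ d z y → a ≡ b
  unique-closer {z} {a} {b} y za zb a≤ b≤ with a ≟F b
  ... | yes a≡b = a≡b
  ... | no  a≢b = ⊥-elim (proj₂ tree (cycle T p av a≢b za (adj-sym T zb)))
    where
    route : Star (Avoiding T z) a b
    route = geodesic _ y refl a≤ (adj⇒≢ T za) ◅◅
            reverse (avoiding-sym T) (geodesic _ y refl b≤ (adj⇒≢ T zb))
    simple = loop-erasure T (adj⇒≢ T za) route
    p  = proj₁ (proj₂ simple)
    av = proj₂ (proj₂ simple)

  -- Otherwise every vertex is x or y, and sending x to 0 and the rest to 1 embeds the vertices in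
  -- `Fin 2`.
  third : ∀ x y → ∃ λ z → z ≢ x × z ≢ y
  third x y with any? (λ z → ¬? (z ≟F x) ×-dec ¬? (z ≟F y))
  ... | yes h  = h
  ... | no  ¬h = ⊥-elim (<-irrefl refl (≤-trans 3≤n (injective⇒≤ {f = f} f-inj)))
    where
    f : Fin n → Fin 2
    f z = if does (z ≟F x) then zero else suc zero
    f-inj : Injective _≡_ _≡_ f
    f-inj {u} {v} eq with u ≟F x | v ≟F x
    ... | yes refl | yes refl = refl
    ... | no  u≢x  | no  v≢x  with u ≟F y | v ≟F y
    ... | yes refl | yes refl = refl
    ... | no  u≢y  | _        = ⊥-elim (¬h (u , u≢x , u≢y))
    ... | yes _    | no  v≢y  = ⊥-elim (¬h (v , v≢x , v≢y))

  neighbour : ∀ v → ∃ (Adj v)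
  neighbour v with third v v
  ... | z , z≢v , _ with closer v z (λ eq → z≢v (≡-sym eq))
  ... | a , e , _ = a , e

  leaf-unique : ∀ {x a b} → Leaf x → Adj x a → Adj x b → a ≡ b
  leaf-unique {x} lx = countV≤1⇒≡ T (adj T x) (≤-reflexive (≡ᵇ-true⁻ _ _ lx)) _ _

  unique⇒leaf : ∀ {x} → (∀ a b → Adj x a → Adj x b → a ≡ b) → Leaf x
  unique⇒leaf {x} h =
    ≡ᵇ-true (≤-antisym (≡⇒countV≤1 T (adj T x) h) (countV>0 T _ _ (proj₂ (neighbour x))))

  two-neighbours : ∀ {v} → Inner v → ∃ λ a → ∃ λ b → Adj v a × Adj v b × a ≢ b
  two-neighbours {v} iv = countV≥2⇒≢ T (adj T v)
    (≤∧≢⇒< (countV>0 T _ _ (proj₂ (neighbour v))) λ eq → true≢false (≡ᵇ-true (≡-sym eq)) iv)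

  -- Two adjacent leaves would form a component by themselves, leaving out the vertex supplied by
  -- `third`.
  leaf-neighbour-inner : ∀ {x y} → Leaf x → Adj x y → Inner y
  leaf-neighbour-inner {x} {y} lx e with leaf-or-inner y
  ... | inj₂ iy = iy
  ... | inj₁ ly with third x y
  ... | z , z≢x , z≢y = ⊥-elim (out (walk-closed (λ v → v ≡ x ⊎ v ≡ y) cl (d-walk x z) (inj₁ refl)))
    where
    cl : ∀ {u v} → Adj u v → u ≡ x ⊎ u ≡ y → v ≡ x ⊎ v ≡ y
    cl e′ (inj₁ refl) = inj₂ (leaf-unique lx e′ e)
    cl e′ (inj₂ refl) = inj₁ (leaf-unique ly e′ (adj-sym T e))
    out : z ≡ x ⊎ z ≡ y → ⊥
    out (inj₁ eq) = z≢x eq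
    out (inj₂ eq) = z≢y eq

  leafNbr innerNbr : Fin n → Fin n → Bool
  leafNbr  v y = adj T v y ∧ isLeaf T y
  innerNbr v y = adj T v y ∧ not (isLeaf T y)

  support : ∀ {v y} → Adj v y → Leaf y → Support v
  support {v} {y} e ly with leafNbrs T v | countV>0 T (leafNbr v) y (∧-true e ly)
  ... | suc _ | _ = refl

  support⁻ : ∀ {v} → Support v → 1 ≤ leafNbrs T v
  support⁻ {v} sv with leafNbrs T v
  ... | suc _ = s≤s z≤n

  first-leaf : ∀ {v} → Support v → ∃ λ y → Adj v y × Leaf y × rank (leafNbr v) y ≡ 0
  first-leaf {v} sv with selectV T (leafNbr v) 0 (support⁻ sv)
  ... | y , py , ry = y , proj₁ (∧-true⁻ _ py) , proj₂ (∧-true⁻ (adj T v y) py) , ry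

  support-inner : ∀ {v} → Support v → Inner v
  support-inner sv with first-leaf sv
  ... | y , e , ly , _ = leaf-neighbour-inner ly (adj-sym T e)

  leafNbrs≤max : ∀ v → leafNbrs T v ≤ maxLeafNbrs T
  leafNbrs≤max v = subst (_≤ maxLeafNbrs T) (if-positive (leafNbrs T v))
    (f≤maxV T (λ v → if isSupport T v then leafNbrs T v else 0) v)

  degInner≤Δ : ∀ {v} → Inner v → degInner T v ≤ ΔInner T
  degInner≤Δ {v} iv = subst (_≤ ΔInner T) (cong (λ b → if b then 0 else degInner T v) iv)
    (f≤maxV T (λ v → if isLeaf T v then 0 else degInner T v) v)

  -- Walking away from y as long as inner vertices permit, the lead of u over y is kept by the triangle inequality.
  climb : ∀ {y u} → y ≢ u → Inner u → ∃ λ s → Support s × d u s < d y s × degInner T s ≤ 1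
  climb {y} {u} y≢u iu = go (maxV T (λ s → d s y)) u (m≤n+m _ _) iu
      (subst (_< d y u) (≡-sym (d-refl u)) (n≢0⇒n>0 λ eq → y≢u (d≡0⇒≡ eq)))
    where
    -- The distance from y grows with each step, so its maximum over all vertices bounds the number
    -- of steps.
    go : ∀ fuel s → maxV T (λ s → d s y) ≤ d s y + fuel → Inner s → d u s < d y s →
         ∃ λ s → Support s × d u s < d y s × degInner T s ≤ 1
    go fuel s bound is lead
      with any? (λ t → (adj T s t ≟B true) ×-dec ((isLeaf T t ≟B false) ×-dec (d s y <? d t y)))
    go zero s bound is lead | yes (t , e , it , s<t) =
      ⊥-elim (<-irrefl refl (≤-trans s<t
        (≤-trans (f≤maxV T (λ s → d s y) t) (subst (_ ≤_) (+-identityʳ _) bound))))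
    go (suc fuel) s bound is lead | yes (t , e , it , s<t) =
      go fuel t (≤-trans bound (≤-trans (≤-reflexive (+-suc _ _)) (+-monoˡ-≤ fuel s<t))) it
        (subst₂ _<_ (d-sym t u) (d-sym t y)
          (≤-<-trans (d-adj u (adj-sym T e)) (≤-<-trans (subst₂ _<_ (d-sym u s) (d-sym y s) lead) s<t)))
    -- Now every neighbour of s farther from y is a leaf. By `unique-closer` at most one neighbour
    -- is not farther, so s has at most one inner neighbour, and one of its two neighbours a and b
    -- is a leaf.
    go fuel s bound is lead | no ¬∃ with two-neighbours is
    ... | a , b , sa , sb , a≢b = s , supp , lead , ≡⇒countV≤1 T (innerNbr s) one
      where
      one : ∀ x x′ → innerNbr s x ≡ true → innerNbr s x′ ≡ true → x ≡ x′
      one x x′ px px′ = unique-closer y (proj₁ (∧-true⁻ _ px)) (proj₁ (∧-true⁻ _ px′)) (le px) (le px′)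
        where
        le : ∀ {x} → innerNbr s x ≡ true → d x y ≤ d s y
        le {x} px with ∧-true⁻ (adj T s x) px
        ... | e , ix = ≮⇒≥ λ lt → ¬∃ (x , e , not-true⁻ ix , lt)
      far : ∀ {x} → Adj s x → d s y < d x y → Support s
      far {x} e lt with leaf-or-inner x
      ... | inj₁ lx = support e lx
      ... | inj₂ ix = ⊥-elim (¬∃ (x , e , ix , lt))
      supp : Support s
      supp with d s y <? d a y | d s y <? d b y
      ... | yes lt | _      = far sa lt
      ... | no _   | yes lt = far sb lt
      ... | no ¬a  | no ¬b  = ⊥-elim (a≢b (unique-closer y sa sb (≮⇒≥ ¬a) (≮⇒≥ ¬b)))

  -- Climbing in both directions yields a support vertex nearer to y and one nearer to x. They are
  -- distinct, so at least one of them is not w and contradicts `same`.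
  resolve : ∀ {x y} w → Inner x → Inner y → (∀ v → Support v → v ≢ w → d x v ≡ d y v) → x ≡ y
  resolve {x} {y} w ix iy same with x ≟F y
  ... | yes x≡y = x≡y
  ... | no  x≢y with climb x≢y iy | climb (λ eq → x≢y (≡-sym eq)) ix
  ... | s , ss , ys<xs , _ | s′ , ss′ , xs′<ys′ , _ with s ≟F w | s′ ≟F w
  ... | no s≢w   | _        = ⊥-elim (<-irrefl (≡-sym (same s ss s≢w)) ys<xs)
  ... | yes _    | no s′≢w  = ⊥-elim (<-irrefl (same s′ ss′ s′≢w) xs′<ys′)
  ... | yes refl | yes refl = ⊥-elim (<-asym ys<xs xs′<ys′)

-- Transpositions of colours.

abstract

  swap : ℕ → ℕ → ℕ → ℕ
  swap a b i with i ≟ a | i ≟ b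
  ... | yes _ | _     = b
  ... | no _  | yes _ = a
  ... | no _  | no _  = i

  swap-at : ∀ a b → swap a b a ≡ b
  swap-at a b with a ≟ a
  ... | yes _   = refl
  ... | no  a≢a = ⊥-elim (a≢a refl)

  swap-fix : ∀ {a b i} → i ≢ a → i ≢ b → swap a b i ≡ i
  swap-fix {a} {b} {i} i≢a i≢b with i ≟ a | i ≟ b
  ... | yes eq | _      = ⊥-elim (i≢a eq)
  ... | no _   | yes eq = ⊥-elim (i≢b eq)
  ... | no _   | no _   = refl

  swap-< : ∀ {a b i m} → a < m → b < m → i < m → swap a b i < m
  swap-< {a} {b} {i} a< b< i< with i ≟ a | i ≟ b
  ... | yes _ | _     = b<
  ... | no _  | yes _ = a<
  ... | no _  | no _  = i<

  swap-injective : ∀ a b {i j} → swap a b i ≡ swap a b j → i ≡ j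
  swap-injective a b {i} {j} eq with i ≟ a | i ≟ b | j ≟ a | j ≟ b
  ... | yes refl | _        | yes refl | _        = refl
  ... | yes refl | _        | no _     | yes refl = ≡-sym eq
  ... | yes refl | _        | no _     | no j≢b   = ⊥-elim (j≢b (≡-sym eq))
  ... | no _     | yes refl | yes refl | _        = ≡-sym eq
  ... | no _     | yes refl | no _     | yes refl = refl
  ... | no _     | yes refl | no j≢a   | no _     = ⊥-elim (j≢a (≡-sym eq))
  ... | no _     | no i≢b   | yes refl | _        = ⊥-elim (i≢b eq)
  ... | no i≢a   | no _     | no _     | yes refl = ⊥-elim (i≢a eq)
  ... | no _     | no _     | no _     | no _     = eq

-- The colouring built from a root support vertex.

module Colouring (T : Graph n) (tree : IsTree T) (3≤n : 3 ≤ n)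
  -- The palette has three blocks: `ΔInner T` colours for inner edges, then q further colours for
  -- leaf edges, then one private mark for each support vertex other than w. By `room` the edges at
  -- w fit into the first two blocks.
  (w : Fin n) (sw : isSupport T w ≡ true) (q : ℕ) (leafNbrs≤ : ∀ v → leafNbrs T v ≤ suc q)
  (room : degInner T w + leafNbrs T w ≤ ΔInner T + q)
  (N : ℕ) (enough : ΔInner T + q + numSupport T ≤ suc N) where

  open Tree T tree 3≤n
  open Walks T

  D : ℕ
  D = ΔInner T

  root-or-not : ∀ v → v ≡ w ⊎ v ≢ w
  root-or-not v with v ≟F w
  ... | yes eq  = inj₁ eq
  ... | no  v≢w = inj₂ v≢w

  marked : Fin n → Bool
  marked v = isSupport T v ∧ not (does (v ≟F w))

  marked-true : ∀ {v} → Support v → v ≢ w → marked v ≡ true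
  marked-true {v} sv v≢w with v ≟F w
  ... | yes eq = ⊥-elim (v≢w eq)
  ... | no _   = ∧-true sv refl

  marked-false : marked w ≡ false
  marked-false with w ≟F w | isSupport T w
  ... | yes _   | true  = refl
  ... | yes _   | false = refl
  ... | no  w≢w | _ = ⊥-elim (w≢w refl)

  -- The leaf of rank 0 at v carries the colour private to v.
  offRoot : Fin n → ℕ → ℕ
  offRoot v zero    = D + q + rank marked v
  offRoot v (suc i) = D + i

  -- At the root the leaf colours follow directly after those of its own inner edges, possibly below
  -- D. This is safe because the edges at the root keep their base colours.
  leafColour : Fin n → ℕ → ℕ
  leafColour v i = if does (v ≟F w) then degInner T w + i else offRoot v i

  base : Fin n → Fin n → ℕ
  base v y = if isLeaf T y then leafColour v (rank (leafNbr v) y) else rank (innerNbr v) y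

  base-inner : ∀ {v y} → Inner y → base v y ≡ rank (innerNbr v) y
  base-inner {v} {y} iy = cong (λ b → if b then leafColour v (rank (leafNbr v) y) else rank (innerNbr v) y) iy

  base-leaf : ∀ {v y} → Leaf y → base v y ≡ leafColour v (rank (leafNbr v) y)
  base-leaf {v} {y} ly = cong (λ b → if b then leafColour v (rank (leafNbr v) y) else rank (innerNbr v) y) ly

  leafColour-root : ∀ i → leafColour w i ≡ degInner T w + i
  leafColour-root i with w ≟F w
  ... | yes _   = refl
  ... | no  w≢w = ⊥-elim (w≢w refl)

  leafColour-off : ∀ {v} i → v ≢ w → leafColour v i ≡ offRoot v i
  leafColour-off {v} i v≢w with v ≟F w
  ... | yes eq = ⊥-elim (v≢w eq)
  ... | no  _  = refl

  base-root : ∀ {y} → Leaf y → base w y ≡ degInner T w + rank (leafNbr w) y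
  base-root ly = trans (base-leaf ly) (leafColour-root _)

  base-off : ∀ {v y} → v ≢ w → Leaf y → base v y ≡ offRoot v (rank (leafNbr v) y)
  base-off v≢w ly = trans (base-leaf ly) (leafColour-off _ v≢w)

  innerNbr-true : ∀ {v y} → Adj v y → Inner y → innerNbr v y ≡ true
  innerNbr-true e iy = ∧-true e (not-true iy)

  leafNbr-true : ∀ {v y} → Adj v y → Leaf y → leafNbr v y ≡ true
  leafNbr-true e ly = ∧-true e ly

  base-inner< : ∀ {v y} → Adj v y → Inner y → base v y < degInner T v
  base-inner< {v} {y} e iy =
    subst (_< degInner T v) (≡-sym (base-inner iy)) (rank<countV T (innerNbr v) y (innerNbr-true e iy))

  D≤offRoot : ∀ v i → D ≤ offRoot v i
  D≤offRoot v zero    = ≤-trans (m≤m+n D q) (m≤m+n (D + q) _)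
  D≤offRoot v (suc i) = m≤m+n D i

  D≤base-off : ∀ {v y} → v ≢ w → Leaf y → D ≤ base v y
  D≤base-off {v} {y} v≢w ly = subst (D ≤_) (≡-sym (base-off v≢w ly)) (D≤offRoot v (rank (leafNbr v) y))

  degInner≤base : ∀ {v y} → Adj v y → Leaf y → degInner T v ≤ base v y
  degInner≤base {v} e ly with root-or-not v
  ... | inj₁ refl = subst (degInner T w ≤_) (≡-sym (base-root ly)) (m≤m+n _ _)
  ... | inj₂ v≢w  = ≤-trans (degInner≤Δ (leaf-neighbour-inner ly (adj-sym T e))) (D≤base-off v≢w ly)

  -- Since v has at most q + 1 leaves, a rank `suc i` has i < q, so its colour stays below the
  -- marks, which begin at D + q.
  offRoot-injective : ∀ v {i j} → i < leafNbrs T v → j < leafNbrs T v → offRoot v i ≡ offRoot v j → i ≡ j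
  offRoot-injective v {zero}  {zero}  i< j< eq = refl
  offRoot-injective v {zero}  {suc j} i< j< eq = ⊥-elim (<-irrefl (≡-sym eq)
    (≤-trans (+-monoʳ-< D (s≤s⁻¹ (≤-trans j< (leafNbrs≤ v)))) (m≤m+n (D + q) _)))
  offRoot-injective v {suc i} {zero}  i< j< eq = ⊥-elim (<-irrefl eq
    (≤-trans (+-monoʳ-< D (s≤s⁻¹ (≤-trans i< (leafNbrs≤ v)))) (m≤m+n (D + q) _)))
  offRoot-injective v {suc i} {suc j} i< j< eq = cong suc (+-cancelˡ-≡ D _ _ eq)

  leafColour-injective : ∀ v {i j} → i < leafNbrs T v → j < leafNbrs T v → leafColour v i ≡ leafColour v j → i ≡ j
  leafColour-injective v i< j< eq with v ≟F w
  ... | yes refl = +-cancelˡ-≡ (degInner T w) _ _ eq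
  ... | no  _    = offRoot-injective v i< j< eq

  -- Inner edges have colours below `degInner T v` and leaf edges have colours from there on, so a
  -- clash could only occur within one kind, where ranks decide.
  base-injective : ∀ {v x y} → Adj v x → Adj v y → base v x ≡ base v y → x ≡ y
  base-injective {v} {x} {y} ex ey eq with leaf-or-inner x | leaf-or-inner y
  ... | inj₂ ix | inj₂ iy = rank-injective (innerNbr v) x y (innerNbr-true ex ix) (innerNbr-true ey iy)
        (trans (≡-sym (base-inner ix)) (trans eq (base-inner iy)))
  ... | inj₂ ix | inj₁ ly = ⊥-elim (<-irrefl eq (≤-trans (base-inner< ex ix) (degInner≤base ey ly)))
  ... | inj₁ lx | inj₂ iy = ⊥-elim (<-irrefl (≡-sym eq) (≤-trans (base-inner< ey iy) (degInner≤base ex lx)))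
  ... | inj₁ lx | inj₁ ly = rank-injective (leafNbr v) x y px py
        (leafColour-injective v (rank<countV T (leafNbr v) x px) (rank<countV T (leafNbr v) y py)
          (trans (≡-sym (base-leaf lx)) (trans eq (base-leaf ly))))
    where
    px = leafNbr-true ex lx
    py = leafNbr-true ey ly

  parent-or-root : ∀ v → v ≡ w ⊎ ∃ λ a → Adj v a × d v w ≡ suc (d a w)
  parent-or-root v with root-or-not v
  ... | inj₁ eq  = inj₁ eq
  ... | inj₂ v≢w = inj₂ (closer v w v≢w)

  abstract

    par : Fin n → Fin n
    par v with parent-or-root v
    -- A default value for the root; `par-spec` speaks of the other vertices.
    ... | inj₁ _       = v
    ... | inj₂ (a , _) = a

    par-spec : ∀ {v} → v ≢ w → Adj v (par v) × d v w ≡ suc (d (par v) w)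
    par-spec {v} v≢w with parent-or-root v
    ... | inj₁ eq          = ⊥-elim (v≢w eq)
    ... | inj₂ (a , e , r) = e , r

  par-unique : ∀ {v x} → v ≢ w → Adj v x → d x w ≤ d v w → x ≡ par v
  par-unique v≢w e le with par-spec v≢w
  ... | e′ , r = unique-closer w e e′ le (≤-trans (n≤1+n _) (≤-reflexive (≡-sym r)))

  -- One end is no farther from w than the other, and `par-unique` makes it the parent. The other
  -- end is not w, since w alone has distance 0 from w.
  edge-orientation : ∀ {x y} → Adj x y → (x ≢ w × y ≡ par x) ⊎ (y ≢ w × x ≡ par y)
  edge-orientation {x} {y} e with ≤-total (d x w) (d y w)
  ... | inj₁ le = inj₂ (y≢w , par-unique y≢w (adj-sym T e) le)
    where
    y≢w : y ≢ w
    y≢w refl = adj⇒≢ T e (d≡0⇒≡ (n≤0⇒n≡0 (subst (d x w ≤_) (d-refl w) le)))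
  ... | inj₂ le = inj₁ (x≢w , par-unique x≢w e le)
    where
    x≢w : x ≢ w
    x≢w refl = adj⇒≢ T e (≡-sym (d≡0⇒≡ (n≤0⇒n≡0 (subst (d y w ≤_) (d-refl w) le))))

  -- A leaf parent would have v as its only neighbour and thus as its own parent, although distances
  -- to w drop at each parent. The root itself is inner, being a support vertex.
  par-inner : ∀ {v} → v ≢ w → Inner (par v)
  par-inner {v} v≢w with leaf-or-inner (par v)
  ... | inj₂ ip = ip
  ... | inj₁ lp with par-spec v≢w
  ... | e , r with par-spec (λ eq → true≢false (subst Leaf eq lp) (support-inner sw))
  ... | e′ , r′ = ⊥-elim (<-irrefl
          (cong (λ u → d u w) (leaf-unique lp e′ (adj-sym T e)))
          (subst (d (par (par v)) w <_) (≡-sym (trans r (cong suc r′))) (s≤s (n≤1+n _))))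

  -- Away from the root, the base colours at v are permuted so that the edge to the parent
  -- receives the colour already chosen for it.
  colourAt : ℕ → Fin n → Fin n → ℕ
  colourAt zero    v y = base v y
  colourAt (suc k) v y = swap (base v (par v)) (colourAt k (par v) v) (base v y)

  colour : Fin n → Fin n → ℕ
  colour v y = colourAt (d v w) v y

  -- The distance to w drops by exactly one at the parent, so the successor clause of `colourAt`
  -- applies at v and refers to `colour (par v) v`.
  colour-par : ∀ {v} → v ≢ w → colour v (par v) ≡ colour (par v) v
  colour-par {v} v≢w = trans (cong (λ k → colourAt k v (par v)) (proj₂ (par-spec v≢w))) (swap-at _ _)

  colour-sym : ∀ {x y} → Adj x y → colour x y ≡ colour y x
  colour-sym e with edge-orientation e
  ... | inj₁ (x≢w , refl) = colour-par x≢w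
  ... | inj₂ (y≢w , refl) = ≡-sym (colour-par y≢w)

  colour-injective : ∀ {v x y} → Adj v x → Adj v y → colour v x ≡ colour v y → x ≡ y
  colour-injective {v} ex ey = go (d v w)
    where
    go : ∀ k → colourAt k v _ ≡ colourAt k v _ → _ ≡ _
    go zero    eq = base-injective ex ey eq
    go (suc k) eq = base-injective ex ey (swap-injective _ _ eq)

  non-root : ∀ {v k} → d v w ≡ suc k → v ≢ w
  non-root eq refl = 0≢1+n (trans (≡-sym (d-refl w)) eq)

  base-inner<D : ∀ {v y} → Inner v → Adj v y → Inner y → base v y < D
  base-inner<D iv e iy = ≤-trans (base-inner< e iy) (degInner≤Δ iv)

  -- A parent is inner, so both exchanged colours belong to inner edges and lie below D; the
  -- transposition preserves that range.
  colourAt-inner : ∀ k {v y} → d v w ≡ k → Inner v → Inner y → Adj v y → colourAt k v y < D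
  colourAt-inner zero    eq iv iy e = base-inner<D iv e iy
  colourAt-inner (suc k) {v} {y} eq iv iy e with par-spec (non-root eq)
  ... | e′ , r = swap-< (base-inner<D iv e′ ip)
                   (colourAt-inner k (suc-injective (trans (≡-sym r) eq)) ip iv (adj-sym T e′)) (base-inner<D iv e iy)
    where ip = par-inner (non-root eq)

  colour-inner : ∀ {v y} → Inner v → Inner y → Adj v y → colour v y < D
  colour-inner = colourAt-inner _ refl

  -- At the root nothing is exchanged. Elsewhere the exchanged colours lie below D, while leaf edges
  -- have base colours of at least D.
  colour-leaf : ∀ {v y} → Leaf y → Adj v y → colour v y ≡ base v y
  colour-leaf {v} {y} ly e = go (d v w) refl
    where
    iv : Inner v
    iv = leaf-neighbour-inner ly (adj-sym T e)
    go : ∀ k → d v w ≡ k → colourAt k v y ≡ base v y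
    go zero    _  = refl
    go (suc k) eq with par-spec (non-root eq)
    ... | e′ , r = swap-fix (big (base-inner<D iv e′ ip))
                     (big (colourAt-inner k (suc-injective (trans (≡-sym r) eq)) ip iv (adj-sym T e′)))
      where
      ip = par-inner (non-root eq)
      big : ∀ {c} → c < D → base v y ≢ c
      big c<D eq′ = <-irrefl (≡-sym eq′) (≤-trans c<D (D≤base-off (non-root eq) ly))

  base-root< : ∀ {y} → Leaf y → Adj w y → base w y < D + q
  base-root< {y} ly e = subst (_< D + q) (≡-sym (base-root ly))
    (≤-trans (+-monoʳ-< (degInner T w) (rank<countV T (leafNbr w) y (leafNbr-true e ly))) room)

  -- The root is a support vertex without a mark, so there are fewer marks than support vertices;
  -- this makes up for the `suc N` in `enough`.
  N-bound : ∀ {j} → j < countV T marked → D + q + j < N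
  N-bound j< = s≤s⁻¹ (≤-trans (s≤s (+-monoʳ-< (D + q) j<))
    (≤-trans (≤-reflexive (≡-sym (+-suc (D + q) _)))
      (≤-trans (+-monoʳ-≤ (D + q) (countV-mono-< T marked (isSupport T) w
        (λ x p → proj₁ (∧-true⁻ _ p)) marked-false sw)) enough)))

  D+q≤N : D + q ≤ N
  D+q≤N = s≤s⁻¹ (≤-trans (≤-reflexive (+-comm 1 (D + q)))
    (≤-trans (+-monoʳ-≤ (D + q) (countV>0 T (isSupport T) w sw)) enough))

  leafedge< : ∀ {v y} → Leaf y → Adj v y → colour v y < N
  leafedge< {v} {y} ly e with root-or-not v
  ... | inj₁ refl = subst (_< N) (≡-sym (colour-leaf ly e)) (≤-trans (base-root< ly e) D+q≤N)
  ... | inj₂ v≢w  = subst (_< N) (≡-sym (trans (colour-leaf ly e) (base-off v≢w ly)))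
                     (go (rank (leafNbr v) y) (rank<countV T (leafNbr v) y (leafNbr-true e ly)))
    where
    go : ∀ i → i < leafNbrs T v → offRoot v i < N
    go zero    _  = N-bound (rank<countV T marked v (marked-true (support e ly) v≢w))
    go (suc i) i< = ≤-trans (+-monoʳ-< D (s≤s⁻¹ (≤-trans i< (leafNbrs≤ v)))) D+q≤N

  colour<N : ∀ {x y} → Adj x y → colour x y < N
  colour<N {x} {y} e with leaf-or-inner x | leaf-or-inner y
  ... | _       | inj₁ ly = leafedge< ly e
  ... | inj₁ lx | inj₂ _  = subst (_< N) (colour-sym (adj-sym T e)) (leafedge< lx (adj-sym T e))
  ... | inj₂ ix | inj₂ iy = ≤-trans (colour-inner ix iy e) (≤-trans (m≤m+n D q) D+q≤N)

  0<N : 0 < N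
  0<N with first-leaf sw
  ... | y , e , _ = ≤-trans (s≤s z≤n) (colour<N e)

  -- A `ProperEdgeColoring` has values on non-edges too, where no bound on `colour` is available;
  -- numbers out of range go to a default colour.
  clamp : ℕ → Fin N
  clamp i with i <? N
  ... | yes i<N = fromℕ< i<N
  ... | no  _   = fromℕ< 0<N

  toℕ-clamp : ∀ {i} → i < N → toℕ (clamp i) ≡ i
  toℕ-clamp {i} i<N with i <? N
  ... | yes _   = toℕ-fromℕ< _
  ... | no  i≮N = ⊥-elim (i≮N i<N)

  clamp-injective : ∀ {i j} → i < N → j < N → clamp i ≡ clamp j → i ≡ j
  clamp-injective i< j< eq = trans (≡-sym (toℕ-clamp i<)) (trans (cong toℕ eq) (toℕ-clamp j<))

  colouring : ProperEdgeColoring T N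
  colouring = record
    { col    = λ x y → clamp (colour x y)
    ; symm   = λ x y e → cong clamp (colour-sym e)
    ; proper = λ x y z ey ez y≢z eq → y≢z (colour-injective ey ez (clamp-injective (colour<N ey) (colour<N ez) eq))
    }

  -- Separation of vertices by their codes.

  mark : Fin n → ℕ
  mark v = D + q + rank marked v

  mark< : ∀ {v} → Support v → v ≢ w → mark v < N
  mark< {v} sv v≢w = N-bound (rank<countV T marked v (marked-true sv v≢w))

  firstLeaf : ∀ {v} → Support v → Fin n
  firstLeaf sv = proj₁ (first-leaf sv)

  firstLeaf-adj : ∀ {v} (sv : Support v) → Adj v (firstLeaf sv)
  firstLeaf-adj sv = proj₁ (proj₂ (first-leaf sv))

  firstLeaf-leaf : ∀ {v} (sv : Support v) → Leaf (firstLeaf sv)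
  firstLeaf-leaf sv = proj₁ (proj₂ (proj₂ (first-leaf sv)))

  firstLeaf-rank : ∀ {v} (sv : Support v) → rank (leafNbr v) (firstLeaf sv) ≡ 0
  firstLeaf-rank sv = proj₂ (proj₂ (proj₂ (first-leaf sv)))

  colour-firstLeaf : ∀ {v} (sv : Support v) → v ≢ w → colour v (firstLeaf sv) ≡ mark v
  colour-firstLeaf {v} sv v≢w = trans (colour-leaf (firstLeaf-leaf sv) (firstLeaf-adj sv))
    (trans (base-off v≢w (firstLeaf-leaf sv)) (cong (offRoot v) (firstLeaf-rank sv)))

  -- Leaf edges at the root, and those of positive rank elsewhere, have colours below D + q. Rank 0
  -- gives the mark of x, which equals that of v only if x is v.
  mark-leafedge : ∀ {v x y} (sv : Support v) → v ≢ w → Leaf y → Adj x y → colour x y ≡ mark v → x ≡ v × y ≡ firstLeaf sv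
  mark-leafedge {v} {x} {y} sv v≢w ly e eq with root-or-not x
  ... | inj₁ refl = ⊥-elim (<-irrefl (trans (≡-sym (colour-leaf ly e)) eq) (≤-trans (base-root< ly e) (m≤m+n (D + q) _)))
  ... | inj₂ x≢w = go (rank (leafNbr x) y) refl (trans (≡-sym (trans (colour-leaf ly e) (base-off x≢w ly))) eq)
    where
    go : ∀ i → rank (leafNbr x) y ≡ i → offRoot x i ≡ mark v → x ≡ v × y ≡ firstLeaf sv
    go zero    r eq′ with rank-injective marked x v (marked-true (support e ly) x≢w) (marked-true sv v≢w)
                            (+-cancelˡ-≡ (D + q) _ _ eq′)
    ... | refl = refl , rank-injective (leafNbr x) y (firstLeaf sv) (leafNbr-true e ly)
                          (leafNbr-true (firstLeaf-adj sv) (firstLeaf-leaf sv)) (trans r (≡-sym (firstLeaf-rank sv)))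
    go (suc i) r eq′ = ⊥-elim (<-irrefl eq′ (≤-trans (+-monoʳ-< D i<q) (m≤m+n (D + q) _)))
      where
      i<q : i < q
      i<q = s≤s⁻¹ (≤-trans (subst (_< leafNbrs T x) r (rank<countV T (leafNbr x) y (leafNbr-true e ly))) (leafNbrs≤ x))

  mark-edge : ∀ {v x y} (sv : Support v) → v ≢ w → Adj x y → colour x y ≡ mark v → x ≡ v ⊎ x ≡ firstLeaf sv
  mark-edge {v} {x} {y} sv v≢w e eq with leaf-or-inner x | leaf-or-inner y
  ... | _       | inj₁ ly = inj₁ (proj₁ (mark-leafedge sv v≢w ly e eq))
  ... | inj₁ lx | inj₂ _  = inj₂ (proj₂ (mark-leafedge sv v≢w lx (adj-sym T e) (trans (colour-sym (adj-sym T e)) eq)))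
  ... | inj₂ ix | inj₂ iy = ⊥-elim (<-irrefl eq (≤-trans (colour-inner ix iy e) (≤-trans (m≤m+n D q) (m≤m+n (D + q) _))))

  -- The colour class of the mark is a single edge, and a walk to its leaf end from any other vertex
  -- passes through v just before. The leaf itself is excluded, since it has distance 0 from the
  -- class but not from v.
  distance-mark : ∀ {v x} (sv : Support v) → v ≢ w → x ≢ firstLeaf sv → DistClass T colouring x (clamp (mark v)) (d x v)
  distance-mark {v} {x} sv v≢w x≢a =
    (v , (firstLeaf sv , firstLeaf-adj sv , cong clamp (colour-firstLeaf sv v≢w)) , d-walk x v) , lower
    where
    lower : ∀ z s → IncColor T colouring z (clamp (mark v)) → Walk T x z s → d x v ≤ s
    lower z s (y , e , eq) walk with mark-edge sv v≢w e (clamp-injective (colour<N e) (mark< sv v≢w) eq)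
    ... | inj₁ refl = d-min walk
    ... | inj₂ refl with walk-reverse walk
    ... | here      = ⊥-elim (x≢a refl)
    ... | step e′ walk′ with leaf-unique (firstLeaf-leaf sv) e′ (adj-sym T (firstLeaf-adj sv))
    ... | refl = ≤-trans (d-min (walk-reverse walk′)) (n≤1+n _)

  SameCode : Fin n → Fin n → Set
  SameCode x y = ∀ i r → DistClass T colouring x i r ⇔ DistClass T colouring y i r

  dist-unique : ∀ {x i r s} → DistClass T colouring x i r → DistClass T colouring x i s → r ≡ s
  dist-unique ((a , ca , wa) , la) ((b , cb , wb) , lb) = ≤-antisym (la b _ cb wb) (lb a _ ca wa)

  -- The colours seen at a vertex are those whose class is at distance 0, so they can be read off
  -- the code.
  incident-transfer : ∀ {x y z} → SameCode x y → Adj x z → ∃ λ u → Adj y u × colour y u ≡ colour x z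
  incident-transfer {x} {y} {z} same e
    with Equivalence.to (same (clamp (colour x z)) 0) ((x , (z , e , refl) , here) , λ _ _ _ _ → z≤n)
  ... | (_ , (u , e′ , eq) , here) , _ = u , e′ , clamp-injective (colour<N e′) (colour<N e) eq

  same-sym : ∀ {x y} → SameCode x y → SameCode y x
  same-sym same i r = mk⇔ (Equivalence.from (same i r)) (Equivalence.to (same i r))

  same-distance : ∀ {x y v} (sv : Support v) → v ≢ w → SameCode x y → x ≢ firstLeaf sv → y ≢ firstLeaf sv → d x v ≡ d y v
  same-distance sv v≢w same x≢ y≢ =
    dist-unique (Equivalence.to (same _ _) (distance-mark sv v≢w x≢)) (distance-mark sv v≢w y≢)

  leaf-inner-differ : ∀ {x y} → Leaf x → Inner y → SameCode x y → ⊥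
  leaf-inner-differ lx iy same with two-neighbours iy
  ... | a , b , ea , eb , a≢b with incident-transfer (same-sym same) ea | incident-transfer (same-sym same) eb
  ... | u , eu , cu | v , ev , cv with leaf-unique lx eu ev
  ... | refl = a≢b (colour-injective ea eb (trans (≡-sym cu) cv))

  -- Such a y also sees the mark of v, so it is v or the first leaf at v, and v is inner.
  firstLeaf-same : ∀ {x y v} (sv : Support v) → v ≢ w → Leaf y → SameCode x y → x ≡ firstLeaf sv → y ≡ x
  firstLeaf-same {x} {y} {v} sv v≢w ly same refl
    with incident-transfer same (adj-sym T (firstLeaf-adj sv))
  ... | u , e , eq with mark-edge sv v≢w e (trans eq (trans (colour-sym (adj-sym T (firstLeaf-adj sv))) (colour-firstLeaf sv v≢w)))
  ... | inj₁ refl = ⊥-elim (true≢false ly (support-inner sv))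
  ... | inj₂ y≡ = y≡

  distance-leaf : ∀ {x b v} → Leaf x → Adj x b → x ≢ v → d x v ≡ suc (d b v)
  distance-leaf {x} {b} {v} lx e x≢v with closer x v x≢v
  ... | a , ea , eq with leaf-unique lx ea e
  ... | refl = eq

  locating : IsEdgeLocating T colouring
  locating x y same with leaf-or-inner x | leaf-or-inner y
  ... | inj₁ lx | inj₂ iy = ⊥-elim (leaf-inner-differ lx iy same)
  ... | inj₂ ix | inj₁ ly = ⊥-elim (leaf-inner-differ ly ix (same-sym same))
  ... | inj₂ ix | inj₂ iy = resolve w ix iy λ v sv v≢w → same-distance sv v≢w same (not-first sv ix) (not-first sv iy)
    where
    not-first : ∀ {z v} (sv : Support v) → Inner z → z ≢ firstLeaf sv
    not-first sv iz refl = true≢false (firstLeaf-leaf sv) iz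
  ... | inj₁ lx | inj₁ ly with neighbour x
  ... | b , eb with incident-transfer same eb
  ... | b′ , eb′ , eq with x ≟F y
  ... | yes x≡y = x≡y
  ... | no  x≢y = ⊥-elim (x≢y (colour-injective (adj-sym T eb) (subst (λ u → Adj u y) (≡-sym b≡b′) (adj-sym T eb′))
        (trans (colour-sym (adj-sym T eb)) (trans (≡-sym eq)
          (trans (colour-sym eb′) (cong (λ u → colour u y) (≡-sym b≡b′)))))))
    where
    -- A leaf is one farther from each support vertex than its neighbour is, so b and b′ have equal
    -- distances to all support vertices but w. If x or y were a first leaf, to which
    -- `distance-mark` does not apply, `firstLeaf-same` would already give x ≡ y.
    b≡b′ : b ≡ b′
    b≡b′ = resolve w (leaf-neighbour-inner lx eb) (leaf-neighbour-inner ly eb′) λ v sv v≢w →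
      suc-injective (trans (≡-sym (distance-leaf lx eb λ { refl → true≢false lx (support-inner sv) }))
        (trans (same-distance sv v≢w same
                 (λ x≡ → x≢y (≡-sym (firstLeaf-same sv v≢w ly same x≡)))
                 (λ y≡ → x≢y (firstLeaf-same sv v≢w lx (same-sym same) y≡)))
          (distance-leaf ly eb′ λ { refl → true≢false ly (support-inner sv) })))

-- Double stars

private variable
  p : ℕ

-- The vertices of the double star sorted by side: the flag tells the centres apart and assigns each
-- leaf to its centre.
data StarVertex (p : ℕ) : Set where
  centre : Bool → StarVertex p
  leaf   : Bool → Fin p → StarVertex p

starAdj : StarVertex p → StarVertex p → Bool
starAdj (centre a) (centre b) = a xor b
starAdj (centre a) (leaf b _) = not (a xor b)
starAdj (leaf a _) (centre b) = not (b xor a)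
starAdj (leaf _ _) (leaf _ _) = false

encode : StarVertex p → Fin (2 + p + p)
encode     (centre false) = zero
encode     (centre true)  = suc zero
encode {p} (leaf false j) = suc (suc (j ↑ˡ p))
encode {p} (leaf true j)  = suc (suc (p ↑ʳ j))

decode : Fin (2 + p + p) → StarVertex p
decode     zero          = centre false
decode     (suc zero)    = centre true
decode {p} (suc (suc i)) = [ leaf false , leaf true ]′ (splitAt p i)

decode-encode : ∀ (v : StarVertex p) → decode {p} (encode {p} v) ≡ v
decode-encode     (centre false) = refl
decode-encode     (centre true)  = refl
decode-encode {p} (leaf false j) = cong [ leaf false , leaf true ]′ (splitAt-↑ˡ p j p)
decode-encode {p} (leaf true j)  = cong [ leaf false , leaf true ]′ (splitAt-↑ʳ p p j)

encode-decode : ∀ (i : Fin (2 + p + p)) → encode {p} (decode {p} i) ≡ i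
encode-decode     zero          = refl
encode-decode     (suc zero)    = refl
encode-decode {p} (suc (suc i)) with splitAt p i in eq
... | inj₁ j = cong (λ i → suc (suc i)) (splitAt⁻¹-↑ˡ eq)
... | inj₂ j = cong (λ i → suc (suc i)) (splitAt⁻¹-↑ʳ eq)

<⇒<ᵇ-true : ∀ {a b} → a < b → (a <ᵇ b) ≡ true
<⇒<ᵇ-true {zero}  (s≤s _) = refl
<⇒<ᵇ-true {suc a} (s≤s h) = <⇒<ᵇ-true h

≥⇒<ᵇ-false : ∀ {a b} → b ≤ a → (a <ᵇ b) ≡ false
≥⇒<ᵇ-false z≤n     = refl
≥⇒<ᵇ-false (s≤s h) = ≥⇒<ᵇ-false h

doubleStarAdj-leaf : ∀ a b (j : Fin p) →
                     doubleStarAdj p (encode {p} (centre a)) (encode {p} (leaf b j)) ≡ not (a xor b)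
doubleStarAdj-leaf {p} false false j
  rewrite toℕ-↑ˡ j p | <⇒<ᵇ-true (toℕ<n j) = refl
doubleStarAdj-leaf {p} true  false j
  rewrite toℕ-↑ˡ j p | ≥⇒<ᵇ-false (toℕ<n j) = refl
doubleStarAdj-leaf {p} false true  j
  rewrite toℕ-↑ʳ p j | ≥⇒<ᵇ-false (m≤m+n p (toℕ j)) = refl
doubleStarAdj-leaf {p} true  true  j
  rewrite toℕ-↑ʳ p j | <⇒<ᵇ-true (s≤s (m≤m+n p (toℕ j))) = refl

doubleStarAdj-sym : ∀ p i j → doubleStarAdj p i j ≡ doubleStarAdj p j i
doubleStarAdj-sym p i j = ∨-comm (dsEdge p (toℕ i) (toℕ j)) (dsEdge p (toℕ j) (toℕ i))

doubleStarAdj-encode : ∀ (u v : StarVertex p) → doubleStarAdj p (encode {p} u) (encode {p} v) ≡ starAdj u v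
doubleStarAdj-encode (centre false) (centre false) = refl
doubleStarAdj-encode (centre false) (centre true)  = refl
doubleStarAdj-encode (centre true)  (centre false) = refl
doubleStarAdj-encode (centre true)  (centre true)  = refl
doubleStarAdj-encode (centre a) (leaf b j) = doubleStarAdj-leaf a b j
doubleStarAdj-encode {p} (leaf a i) (centre b) =
  trans (doubleStarAdj-sym p (encode {p} (leaf a i)) (encode {p} (centre b))) (doubleStarAdj-leaf b a i)
doubleStarAdj-encode (leaf false i) (leaf false j) = refl
doubleStarAdj-encode (leaf false i) (leaf true j)  = refl
doubleStarAdj-encode (leaf true i)  (leaf false j) = refl
doubleStarAdj-encode (leaf true i)  (leaf true j)  = refl

xor-diag : ∀ a → a xor a ≡ false
xor-diag false = refl
xor-diag true  = refl

xor-true⁻ : ∀ a b → a xor b ≡ true → b ≡ not a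
xor-true⁻ false true  _ = refl
xor-true⁻ true  false _ = refl

xor-not : ∀ a → a xor (not a) ≡ true
xor-not false = refl
xor-not true  = refl

not-xor-true⁻ : ∀ a b → not (a xor b) ≡ true → b ≡ a
not-xor-true⁻ false false _ = refl
not-xor-true⁻ true  true  _ = refl

-- Vertices that see every colour.

module _ (G : Graph n) where

  -- With the colour i removed from the palette, the edges at v still have distinct colours among
  -- the remaining k.
  missing-colour : ∀ {k} (c : ProperEdgeColoring G (suc k)) {v} i →
                   (∀ y → adj G v y ≡ true → i ≢ ProperEdgeColoring.col c v y) → deg G v ≤ k
  missing-colour c {v} i i≢ = countV-≤ G (adj G v) (λ y e → punchOut (i≢ y e)) injective
    where
    injective : ∀ x y ex ey → punchOut (i≢ x ex) ≡ punchOut (i≢ y ey) → x ≡ y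
    injective x y ex ey eq with x ≟F y
    ... | yes x≡y = x≡y
    ... | no  x≢y = ⊥-elim (ProperEdgeColoring.proper c v x y ex ey x≢y (punchOut-injective (i≢ x ex) (i≢ y ey) eq))

  saturated : ∀ {k} (c : ProperEdgeColoring G k) {v} → k ≤ deg G v → ∀ i → IncColor G c v i
  saturated {suc k} c {v} k≤ i with any? (λ y → (adj G v y ≟B true) ×-dec (ProperEdgeColoring.col c v y ≟F i))
  ... | yes h  = h
  ... | no  ¬h = ⊥-elim (<-irrefl refl (≤-trans k≤ (missing-colour c i λ y e eq → ¬h (y , e , ≡-sym eq))))

  saturated-dist : ∀ {k} (c : ProperEdgeColoring G k) {v w} → k ≤ deg G v → k ≤ deg G w →
                   ∀ i r → DistClass G c v i r → DistClass G c w i r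
  saturated-dist c {v} {w} kv kw i r (_ , least-r) with n≤0⇒n≡0 (least-r v 0 (saturated c kv i) here)
  ... | refl = (w , saturated c kw i , here) , λ _ _ _ _ → z≤n

  -- A vertex of degree at least k sees all k colours, so its code is zero throughout; two such
  -- vertices share it.
  saturated-unique : ∀ {k} {v w} → HasELC G k → k ≤ deg G v → k ≤ deg G w → v ≡ w
  saturated-unique (c , locating) kv kw =
    locating _ _ λ i r → mk⇔ (saturated-dist c kv kw i r) (saturated-dist c kw kv i r)

m≤1+[m∸1] : ∀ m → m ≤ suc (m ∸ 1)
m≤1+[m∸1] zero    = z≤n
m≤1+[m∸1] (suc m) = ≤-refl

boolFin : Bool → Fin 2
boolFin false = zero
boolFin true  = suc zero

boolFin-injective : ∀ a b → boolFin a ≡ boolFin b → a ≡ b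
boolFin-injective false false _ = refl
boolFin-injective true  true  _ = refl

-- The bound and its improvement.

module Bounds (T : Graph n) (tree : IsTree T) (3≤n : 3 ≤ n) where

  open Tree T tree 3≤n
  open Walks T

  bound : ℕ
  bound = ΔInner T + maxLeafNbrs T + numSupport T ∸ 1

  abstract

    some-support : ∃ Support
    some-support with neighbour (fromℕ< 3≤n)
    ... | y , e with leaf-or-inner y
    ... | inj₁ ly = _ , support e ly
    ... | inj₂ iy with climb (adj⇒≢ T e) iy
    ... | s , ss , _ = s , ss

  upper-bound : HasELC T bound
  upper-bound with some-support
  ... | w , sw = C.colouring , C.locating
    where
    -- With q equal to `maxLeafNbrs T` the condition `room` holds at every root, and `enough` then
    -- asks for exactly `bound` colours.
    module C = Colouring T tree 3≤n w sw (maxLeafNbrs T) (λ v → ≤-trans (leafNbrs≤max v) (n≤1+n _))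
      (+-mono-≤ (degInner≤Δ (support-inner sw)) (leafNbrs≤max w)) bound (m≤1+[m∸1] _)

  -- Strict inequality at w means that `room` still holds with q one smaller, which saves a colour.
  improved-bound : ∀ {w} → Support w → degInner T w + leafNbrs T w < ΔInner T + maxLeafNbrs T →
                   HasELC T (bound ∸ 1) × bound ∸ 1 < bound
  improved-bound {w} sw lt = go (maxLeafNbrs T) leafNbrs≤max lt
    where
    -- The maximum is generalised to L so that it can be matched against `suc q`; L = 0 would
    -- contradict that w has a leaf.
    go : ∀ L → (∀ v → leafNbrs T v ≤ L) → degInner T w + leafNbrs T w < ΔInner T + L →
         let B = ΔInner T + L + numSupport T ∸ 1 in HasELC T (B ∸ 1) × B ∸ 1 < B
    go zero    ≤L _ = ⊥-elim (<-irrefl refl (≤-trans (support⁻ sw) (≤L w)))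
    go (suc q) ≤L lt rewrite +-suc (ΔInner T) q = (C.colouring , C.locating) ,
        -- There is a support vertex, so the truncated subtraction does lower the bound.
        ∸-monoʳ-< {o = 0} (s≤s z≤n) (≤-trans (countV>0 T (isSupport T) w sw) (m≤n+m _ (ΔInner T + q)))
      where
      module C = Colouring T tree 3≤n w sw q ≤L (s≤s⁻¹ lt) (ΔInner T + q + numSupport T ∸ 1) (m≤1+[m∸1] _)

  -- Double stars attain the bound.

  module FromDoubleStar (p : ℕ) (f : Fin n ↔ Fin (2 + p + p))
    (f-adj : ∀ x y → adj T x y ≡ doubleStarAdj p (Inverse.to f x) (Inverse.to f y)) where

    at : StarVertex p → Fin n
    at v = Inverse.from f (encode {p} v)

    vertex : ∀ x → ∃ λ v → x ≡ at v
    vertex x = decode {p} (Inverse.to f x) ,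
      ≡-sym (trans (cong (Inverse.from f) (encode-decode {p} _)) (Inverse.strictlyInverseʳ f x))

    at-injective : ∀ {u v} → at u ≡ at v → u ≡ v
    at-injective {u} {v} eq = trans (≡-sym (decode-encode u)) (trans (cong (decode {p}) e) (decode-encode v))
      where
      e : encode {p} u ≡ encode {p} v
      e = trans (≡-sym (Inverse.strictlyInverseˡ f _)) (trans (cong (Inverse.to f) eq) (Inverse.strictlyInverseˡ f _))

    at-adj : ∀ u v → adj T (at u) (at v) ≡ starAdj u v
    at-adj u v = trans (f-adj _ _) (trans
      (cong₂ (doubleStarAdj p) (Inverse.strictlyInverseˡ f _) (Inverse.strictlyInverseˡ f _)) (doubleStarAdj-encode u v))

    1≤p : 1 ≤ p
    1≤p = go p (≤-trans 3≤n (injective⇒≤ {f = Inverse.to f} to-injective))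
      where
      to-injective : Injective _≡_ _≡_ (Inverse.to f)
      to-injective eq = trans (≡-sym (Inverse.strictlyInverseʳ f _))
        (trans (cong (Inverse.from f) eq) (Inverse.strictlyInverseʳ f _))
      go : ∀ p → 3 ≤ 2 + p + p → 1 ≤ p
      go zero    (s≤s (s≤s ()))
      go (suc p) _ = s≤s z≤n

    leaf-nbr : ∀ a (j : Fin p) (v : StarVertex p) → starAdj (leaf a j) v ≡ true → v ≡ centre a
    leaf-nbr a j (centre b) e = cong centre (≡-sym (not-xor-true⁻ b a e))

    leaf-is-leaf : ∀ a (j : Fin p) → Leaf (at (leaf a j))
    leaf-is-leaf a j = unique⇒leaf λ x y ex ey → trans (only x ex) (≡-sym (only y ey))
      where
      only : ∀ x → Adj (at (leaf a j)) x → x ≡ at (centre a)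
      only x e with vertex x
      ... | v , refl = cong at (leaf-nbr a j v (trans (≡-sym (at-adj (leaf a j) v)) e))

    deg-centre : ∀ a → suc p ≤ deg T (at (centre a))
    deg-centre a = countV-≥ T (adj T (at (centre a))) nbr nbr-injective
        λ { zero → trans (at-adj _ _) (xor-not a) ; (suc j) → trans (at-adj _ _) (cong not (xor-diag a)) }
      where
      nbr : Fin (suc p) → Fin n
      nbr zero    = at (centre (not a))
      nbr (suc j) = at (leaf a j)
      nbr-injective : Injective _≡_ _≡_ nbr
      nbr-injective {zero}  {zero}  eq = refl
      nbr-injective {zero}  {suc j} eq with at-injective eq
      ... | ()
      nbr-injective {suc i} {zero}  eq with at-injective eq
      ... | ()
      nbr-injective {suc i} {suc j} eq with at-injective eq
      ... | refl = refl

    centre-inner : ∀ a → Inner (at (centre a))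
    centre-inner a with leaf-or-inner (at (centre a))
    ... | inj₂ i = i
    ... | inj₁ l = ⊥-elim (<-irrefl (≡-sym (≡ᵇ-true⁻ _ _ l)) (≤-trans (s≤s 1≤p) (deg-centre a)))

    inner⇒centre : ∀ {x} → Inner x → ∃ λ a → x ≡ at (centre a)
    inner⇒centre {x} ix with vertex x
    ... | centre a , eq   = a , eq
    ... | leaf a j , refl = ⊥-elim (true≢false (leaf-is-leaf a j) ix)

    leaf⇒leaf : ∀ {x a} → Leaf x → Adj (at (centre a)) x → ∃ λ j → x ≡ at (leaf a j)
    leaf⇒leaf {x} {a} lx e with vertex x
    ... | centre b , refl = ⊥-elim (true≢false lx (centre-inner b))
    ... | leaf b j , refl with not-xor-true⁻ a b (trans (≡-sym (at-adj (centre a) (leaf b j))) e)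
    ... | refl = j , refl

    numSupport≤2 : numSupport T ≤ 2
    numSupport≤2 = countV-≤ T (isSupport T) (λ x sx → boolFin (proj₁ (inner⇒centre (support-inner sx))))
      λ x y sx sy eq → trans (proj₂ (inner⇒centre (support-inner sx)))
        (trans (cong (at ∘ centre) (boolFin-injective _ _ eq)) (≡-sym (proj₂ (inner⇒centre (support-inner sy)))))

    leafNbrs≤p : ∀ v → leafNbrs T v ≤ p
    leafNbrs≤p v with leaf-or-inner v
    ... | inj₁ lv = countV-≤ T (leafNbr v) (λ y py → ⊥-elim (none y py)) (λ y _ py _ _ → ⊥-elim (none y py))
      where
      none : ∀ y → leafNbr v y ≡ true → ⊥
      none y py with ∧-true⁻ (adj T v y) py
      ... | e , ly = true≢false ly (leaf-neighbour-inner lv e)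
    ... | inj₂ iv with inner⇒centre iv
    ... | a , refl = countV-≤ T (leafNbr v) (λ y py → proj₁ (nbr y py)) λ x y px py eq →
          trans (proj₂ (nbr x px)) (trans (cong (at ∘ leaf a) eq) (≡-sym (proj₂ (nbr y py))))
      where
      nbr : ∀ y → leafNbr v y ≡ true → ∃ λ j → y ≡ at (leaf a j)
      nbr y py with ∧-true⁻ (adj T v y) py
      ... | e , ly = leaf⇒leaf ly e

    degInner≤1 : ∀ {v} → Inner v → degInner T v ≤ 1
    degInner≤1 {v} iv with inner⇒centre iv
    ... | a , refl = ≡⇒countV≤1 T (innerNbr v) λ x y px py → trans (only x px) (≡-sym (only y py))
      where
      only : ∀ y → innerNbr v y ≡ true → y ≡ at (centre (not a))
      only y py with ∧-true⁻ (adj T v y) py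
      ... | e , ny with inner⇒centre (not-true⁻ ny)
      ... | b , refl = cong (at ∘ centre) (xor-true⁻ a b (trans (≡-sym (at-adj (centre a) (centre b))) e))

    maxLeafNbrs≤p : maxLeafNbrs T ≤ p
    maxLeafNbrs≤p = maxV≤ T _ p λ v → ≤-trans (≤-reflexive (if-positive (leafNbrs T v))) (leafNbrs≤p v)

    ΔInner≤1 : ΔInner T ≤ 1
    ΔInner≤1 = maxV≤ T _ 1 λ v → go v (leaf-or-inner v)
      where
      go : ∀ v → Leaf v ⊎ Inner v → (if isLeaf T v then 0 else degInner T v) ≤ 1
      go v (inj₁ lv) = ≤-trans (≤-reflexive (cong (λ b → if b then 0 else degInner T v) lv)) z≤n
      go v (inj₂ iv) = ≤-trans (≤-reflexive (cong (λ b → if b then 0 else degInner T v) iv)) (degInner≤1 iv)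

    bound≤2+p : bound ≤ suc (suc p)
    bound≤2+p = ≤-trans (∸-monoˡ-≤ 1 (+-mono-≤ (+-mono-≤ ΔInner≤1 maxLeafNbrs≤p) numSupport≤2)) (≤-reflexive (+-comm p 2))

    -- Fewer than `bound` colours means at most p + 1. Each centre has at least that degree, so both
    -- would be saturated and have the same code.
    attained : ChiL≡ T bound
    attained = upper-bound , λ k k<bound elc →
      let small : ∀ a → k ≤ deg T (at (centre a))
          small a = ≤-trans (s≤s⁻¹ (≤-trans k<bound bound≤2+p)) (deg-centre a)
      in absurd (at-injective (saturated-unique T elc (small false) (small true)))
      where
      absurd : centre {p} false ≡ centre true → ⊥
      absurd ()

  -- Trees without an improving root are double stars.

  module Extremal (Δ<m : Δ T < leafSum T)
    (extremal : ∀ {w} → Support w → ΔInner T + maxLeafNbrs T ≤ degInner T w + leafNbrs T w) where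

    -- The two summands in `extremal` are bounded separately, so a sum that reaches both bounds
    -- forces equality in each.
    degInner≡ : ∀ {w} → Support w → degInner T w ≡ ΔInner T
    degInner≡ {w} sw = ≤-antisym (degInner≤Δ (support-inner sw))
      (+-cancelʳ-≤ (maxLeafNbrs T) _ _ (≤-trans (extremal sw) (+-monoʳ-≤ (degInner T w) (leafNbrs≤max w))))

    leafNbrs≡ : ∀ {w} → Support w → leafNbrs T w ≡ maxLeafNbrs T
    leafNbrs≡ {w} sw = ≤-antisym (leafNbrs≤max w)
      (+-cancelˡ-≤ (ΔInner T) _ _ (≤-trans (extremal sw) (+-monoˡ-≤ (leafNbrs T w) (degInner≤Δ (support-inner sw)))))

    -- Without an inner neighbour, w and its leaves would be closed under adjacency and T would be a
    -- star. Its only support vertex is then w, so `leafSum T` is at most the degree of w, against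
    -- `Δ<m`.
    not-star : ∀ {w} → Support w → 1 ≤ degInner T w
    not-star {w} sw = n≢0⇒n>0 λ eq → <-irrefl refl (≤-trans Δ<m (star eq))
      where
      module _ (eq : degInner T w ≡ 0) where
        InStar : Fin n → Set
        InStar z = z ≡ w ⊎ (Adj w z × Leaf z)
        closed : ∀ {x y} → Adj x y → InStar x → InStar y
        closed {y = y} e (inj₁ refl) with leaf-or-inner y
        ... | inj₁ ly = inj₂ (e , ly)
        ... | inj₂ iy = ⊥-elim (<-irrefl (≡-sym eq) (countV>0 T (innerNbr w) y (∧-true e (not-true iy))))
        closed e (inj₂ (e′ , lx)) = inj₁ (leaf-unique lx e (adj-sym T e′))
        all-in : ∀ z → InStar z
        all-in z = walk-closed InStar closed (d-walk w z) (inj₁ refl)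
        none : ∀ v → v ≢ w → (if isSupport T v then leafNbrs T v else 0) ≡ 0
        none v v≢w with all-in v
        ... | inj₁ v≡w = ⊥-elim (v≢w v≡w)
        ... | inj₂ (_ , lv) with isSupport T v in sv
        ... | true  = ⊥-elim (true≢false lv (support-inner sv))
        ... | false = refl
        star : leafSum T ≤ Δ T
        star = ≤-trans (sumV-single T _ w none) (≤-trans (≤-reflexive (if-positive (leafNbrs T w)))
          (≤-trans (countV-mono T (leafNbr w) (adj T w) (λ x px → proj₁ (∧-true⁻ _ px))) (f≤maxV T (deg T) w)))

    ℓ : ℕ
    ℓ = maxLeafNbrs T

    w : Fin n
    w = proj₁ some-support

    sw : Support w
    sw = proj₂ some-support

    abstract

      inner-neighbour : ∃ λ u → Adj w u × Inner u
      inner-neighbour with selectV T (innerNbr w) 0 (not-star sw)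
      ... | u , pu , _ with ∧-true⁻ (adj T w u) pu
      ... | e , nu = u , e , not-true⁻ nu

    u : Fin n
    u = proj₁ inner-neighbour

    wu : Adj w u
    wu = proj₁ (proj₂ inner-neighbour)

    -- Every support vertex has exactly `ΔInner T` inner neighbours, and `climb` ends at one with at
    -- most one.
    ΔInner≤1 : ΔInner T ≤ 1
    ΔInner≤1 with climb (adj⇒≢ T wu) (proj₂ (proj₂ inner-neighbour))
    ... | s , ss , _ , s≤1 = subst (_≤ 1) (degInner≡ ss) s≤1

    inner-unique : ∀ {v x y} → Inner v → Adj v x → Adj v y → Inner x → Inner y → x ≡ y
    inner-unique {v} iv ex ey ix iy = countV≤1⇒≡ T (innerNbr v) (≤-trans (degInner≤Δ iv) ΔInner≤1) _ _
      (∧-true ex (not-true ix)) (∧-true ey (not-true iy))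

    -- Being inner, u has two neighbours, and at most one of them is inner.
    su : Support u
    su with two-neighbours (proj₂ (proj₂ inner-neighbour))
    ... | a , b , ea , eb , a≢b with leaf-or-inner a | leaf-or-inner b
    ... | inj₁ la | _       = support ea la
    ... | inj₂ _  | inj₁ lb = support eb lb
    ... | inj₂ ia | inj₂ ib = ⊥-elim (a≢b (inner-unique (proj₂ (proj₂ inner-neighbour)) ea eb ia ib))

    c : Bool → Fin n
    c false = w
    c true  = u

    c-support : ∀ a → Support (c a)
    c-support false = sw
    c-support true  = su

    c-adj : ∀ a → Adj (c a) (c (not a))
    c-adj false = wu
    c-adj true  = adj-sym T wu

    abstract

      leaf-at : ∀ a (j : Fin ℓ) → ∃ λ y → leafNbr (c a) y ≡ true × rank (leafNbr (c a)) y ≡ toℕ j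
      leaf-at a j = selectV T (leafNbr (c a)) (toℕ j)
        (≤-trans (toℕ<n j) (≤-reflexive (≡-sym (leafNbrs≡ (c-support a)))))

    at : StarVertex ℓ → Fin n
    at (centre a) = c a
    at (leaf a j) = proj₁ (leaf-at a j)

    leaf-adj : ∀ a j → Adj (c a) (at (leaf a j))
    leaf-adj a j = proj₁ (∧-true⁻ _ (proj₁ (proj₂ (leaf-at a j))))

    leaf-leaf : ∀ a j → Leaf (at (leaf a j))
    leaf-leaf a j = proj₂ (∧-true⁻ (adj T (c a) (at (leaf a j))) (proj₁ (proj₂ (leaf-at a j))))

    c-injective : ∀ a b → c a ≡ c b → a ≡ b
    c-injective false false eq = refl
    c-injective false true  eq = ⊥-elim (adj⇒≢ T (c-adj false) eq)
    c-injective true  false eq = ⊥-elim (adj⇒≢ T (c-adj true) eq)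
    c-injective true  true  eq = refl

    at-injective : ∀ x y → at x ≡ at y → x ≡ y
    at-injective (centre a) (centre b) eq = cong centre (c-injective a b eq)
    at-injective (centre a) (leaf b j) eq = ⊥-elim (true≢false (leaf-leaf b j) (subst Inner eq (support-inner (c-support a))))
    at-injective (leaf a i) (centre b) eq = ⊥-elim (true≢false (leaf-leaf a i) (subst Inner (≡-sym eq) (support-inner (c-support b))))
    at-injective (leaf a i) (leaf b j) eq with c-injective a b
      (leaf-unique (leaf-leaf a i) (adj-sym T (leaf-adj a i)) (adj-sym T (subst (Adj (c b)) (≡-sym eq) (leaf-adj b j))))
    ... | refl = cong (leaf a) (toℕ-injective (trans (≡-sym (proj₂ (proj₂ (leaf-at a i))))
                   (trans (cong (rank (leafNbr (c a))) eq) (proj₂ (proj₂ (leaf-at a j))))))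

    -- By connectedness it suffices that the image is closed under adjacency: the only inner
    -- neighbour of a centre is the other centre, its leaves are exhausted by their ranks below ℓ,
    -- and a leaf leads back to its centre.
    at-surjective : ∀ z → ∃ λ v → at v ≡ z
    at-surjective z = walk-closed (λ z → ∃ λ v → at v ≡ z) closed (d-walk w z) (centre false , refl)
      where
      closed : ∀ {x y} → Adj x y → (∃ λ v → at v ≡ x) → ∃ λ v → at v ≡ y
      closed {y = y} e (centre a , refl) with leaf-or-inner y
      ... | inj₂ iy = centre (not a) , inner-unique (support-inner (c-support a)) (c-adj a) e (support-inner (c-support (not a))) iy
      ... | inj₁ ly = leaf a (fromℕ< r<p) , rank-injective (leafNbr (c a)) _ _ (proj₁ (proj₂ (leaf-at a (fromℕ< r<p)))) py
            (trans (proj₂ (proj₂ (leaf-at a (fromℕ< r<p)))) (toℕ-fromℕ< r<p))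
        where
        py : leafNbr (c a) y ≡ true
        py = ∧-true e ly
        r<p : rank (leafNbr (c a)) y < ℓ
        r<p = ≤-trans (rank<countV T (leafNbr (c a)) y py) (≤-reflexive (leafNbrs≡ (c-support a)))
      closed e (leaf a j , refl) = centre a , leaf-unique (leaf-leaf a j) (adj-sym T (leaf-adj a j)) e

    c-leaf : ∀ a b j → adj T (c a) (at (leaf b j)) ≡ not (a xor b)
    c-leaf a b j with adj T (c a) (at (leaf b j)) in e | a xor b in x
    ... | true  | false = refl
    ... | false | true  = refl
    ... | true  | true  = ⊥-elim (true≢false x (trans (cong (a xor_) (≡-sym a≡b)) (xor-diag a)))
      where
      a≡b : a ≡ b
      a≡b = c-injective a b (leaf-unique (leaf-leaf b j) (adj-sym T e) (adj-sym T (leaf-adj b j)))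
    ... | false | false = ⊥-elim (true≢false
            (subst (λ a → Adj (c a) (at (leaf b j))) (not-xor-true⁻ a b (cong not x)) (leaf-adj b j)) e)

    at-adj : ∀ x y → adj T (at x) (at y) ≡ starAdj x y
    at-adj (centre false) (centre false) = Graph.irrefl T _
    at-adj (centre false) (centre true)  = c-adj false
    at-adj (centre true)  (centre false) = c-adj true
    at-adj (centre true)  (centre true)  = Graph.irrefl T _
    at-adj (centre a) (leaf b j) = c-leaf a b j
    at-adj (leaf a i) (centre b) = trans (Graph.sym T _ _) (c-leaf b a i)
    at-adj (leaf a i) (leaf b j) with adj T (at (leaf a i)) (at (leaf b j)) in e
    ... | false = refl
    ... | true  = ⊥-elim (true≢false (leaf-leaf b j) (leaf-neighbour-inner (leaf-leaf a i) e))

    name : Fin n → StarVertex ℓ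
    name z = proj₁ (at-surjective z)

    at-name : ∀ z → at (name z) ≡ z
    at-name z = proj₂ (at-surjective z)

    doubleStar : IsDoubleStar T
    doubleStar = ℓ , mk↔ₛ′ (encode {ℓ} ∘ name) (at ∘ decode {ℓ})
        (λ i → trans (cong (encode {ℓ}) (at-injective _ _ (at-name (at (decode {ℓ} i))))) (encode-decode {ℓ} i))
        (λ z → trans (cong at (decode-encode (name z))) (at-name z)) ,
      λ x y → trans (cong₂ (adj T) (≡-sym (at-name x)) (≡-sym (at-name y)))
        (trans (at-adj (name x) (name y)) (≡-sym (doubleStarAdj-encode (name x) (name y))))

theorem22 : ∀ {n : ℕ} (T : Graph n) → IsTree T → 3 ≤ n →
    Δ T < leafSum T →
    ChiL≤ T (ΔInner T + maxLeafNbrs T + numSupport T ∸ 1) ×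
    (ChiL≡ T (ΔInner T + maxLeafNbrs T + numSupport T ∸ 1) ⇔ IsDoubleStar T)
theorem22 T tree 3≤n Δ<m = (bound , ≤-refl , upper-bound) , mk⇔ forward backward
  where
  open Bounds T tree 3≤n
  forward : ChiL≡ T bound → IsDoubleStar T
  -- If the bound is the minimum, no support vertex admits `improved-bound`, which is the hypothesis
  -- `extremal`.
  forward (_ , minimal) = Extremal.doubleStar Δ<m λ sw → ≮⇒≥ λ lt →
    let elc , smaller = improved-bound sw lt in minimal _ smaller elc
  backward : IsDoubleStar T → ChiL≡ T bound
  backward (p , f , f-adj) = FromDoubleStar.attained p f f-adj
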